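{- Let $p$ be an odd prime. (1) Take $k=0$. For every $s\ge2$, $$\mathcal M_{V_{s+2,0}}=p\,\mathcal M_{V_{s,0}}+(p-1)\,\mathcal M_{V_{s+1,0}}+p^{s-1}(p-1)(p^2-1).$$ (2) Take $k=1$. For every $s\ge3$ and $0\le t\le p-1$, $$\mathcal M_{V_{s+2,t}}=\sum_{t_2=0}^{p-1}\mathcal M_{V_{s,t_2}}+\sum_{t_1=1}^{p-1}\mathcal M_{V_{s+1,t_1}}+b_{s,t},$$ where $b_{s,t}=p^{s-1}(p-1)(p^2+p+t)$ if $0\le t<\frac{p-1}{2}$ and $b_{s,t}=p^{s-1}(p-1)(p^2+t)$ if $\frac{p-1}{2}\le t\le p-1$.
   Context: Fix an odd prime $p$ and an integer $k\ge 0$. For integers $0\le i<n$ write $\lambda(n,i)=(n-i,1^i)$ for the hook partition of $n$ with $n-i$ boxes in its first row and $i$ further boxes in its first column. If $\mu=\lambda(n',i')$ is obtained from $\lambda(n,i)$ by appending $m=(n'-i')-(n-i)\ge 0$ boxes to the first row and $n''=i'-i\ge 0$ boxes to the first column, we say $\mu$ is obtained by adding the block $B_{m,n''}$ ($m$ horizontal nodes, $n''$ vertical nodes). Put $x_s=p^k(sp-(s+1))$. The relevant part ("column $k$") of the $p$-Bratteli diagram is the graded directed graph with vertices: on floor $2k+1$, $S_i=\lambda(p^k(p-1),i)$ for $0\le i<p^k(p-1)$; on floor $2(k+s)$ ($s\ge1$), $V_{s,l}=\lambda\big(p^k(2sp-(2s+1)),\,x_s+l\big)$ for $0\le l<p^k$;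 on floor $2(k+s)-1$ ($s\ge2$), $W_{s,l'}=\lambda\big(p^k((2s-1)p-2s),\,x_{s-1}+l'\big)$ for $0\le l'<p^{k+1}$; and edges, each labelled by the block added: (E1) $S_i\to V_{1,l}$ exactly when $i=p^kt+l$ with $0\le t\le p-2$, block $B_{p^kt,\,p^k(p-2-t)}$; (E2) for $s\ge2$, $0\le l<p^k$, $0\le\beta\le p-1$: $V_{s-1,l}\to W_{s,pl+\beta}$, block $B_{p^k(p-1)-((p-1)l+\beta),\,(p-1)l+\beta}$; (E3) for $s\ge 2$, $0\le l'<p^{k+1}$ and $t=\lfloor l'/p^k\rfloor$: $W_{s,l'}\to V_{s,l'-p^kt}$, block $B_{p^kt,\,p^k(p-1-t)}$. A path ending at a vertex $v$ is a sequence of edges starting at some $S_i$ and going up one floor at a time to $v$ ($S_i\to V_{1,\cdot}\to W_{2,\cdot}\to V_{2,\cdot}\to W_{3,\cdot}\to\cdots\to v$); $\mathcal P(v)$ is the set of all paths ending at $v$. The blocks of a path are numbered $B^2,B^3,\dots,B^N$: $B^2$ is the block of the edge leaving $S_i$, and for $j\ge2$, $B^{2j-1}$ is the block of the edge into $W_{j,\cdot}$ and $B^{2j}$ the block of the edge into $V_{j,\cdot}$. Write $B^j=B_{m_j,n_j}$. Descents: $1\in\mathrm{Des}(P)$ iff $m_2=p^kt$ with $0\le t<\frac{p-1}{2}$; $2\notin\mathrm{Des}(P)$; for $3\le j<N$, $j\in\mathrm{Des}(P)$ iff $m_j>m_{j+1}$ and $n_j<n_{j+1}$. $\mathrm{des}(P)=|\mathrm{Des}(P)|$.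 The $p^k$-Fibonacci number of a vertex $v$ is $\mathcal M_v=\sum_{P\in\mathcal P(v)}\mathrm{des}(P)$. -}

module Defs where

open import Data.Bool using (if_then_else_)
open import Data.Empty using (⊥)
open import Data.Fin using (Fin; toℕ; fromℕ<; cast; combine)
open import Data.Fin.Properties using (toℕ<n; toℕ-injective; toℕ-fromℕ<; toℕ-combine; any?; combine-injectiveˡ)
open import Data.List using (List; []; _∷_; _++_; map; concatMap; filter; length; upTo; allFin; replicate)
open import Data.List.Membership.Propositional using (_∈_; lose)
open import Data.List.Membership.Propositional.Properties using (∈-map⁺; ∈-map⁻; ∈-concatMap⁺; ∈-allFin)
open import Data.List.Relation.Unary.All using ([])
import Data.List.Relation.Unary.All as All
import Data.List.Relation.Unary.All.Properties as All
open import Data.List.Relation.Unary.AllPairs using ([]; _∷_)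
import Data.List.Relation.Unary.AllPairs as AllPairs
import Data.List.Relation.Unary.AllPairs.Properties as AllPairs
open import Data.List.Relation.Unary.Any using (here)
open import Data.List.Relation.Unary.Unique.Propositional using (Unique)
import Data.List.Relation.Unary.Unique.Propositional.Properties as Unique
open import Data.Maybe using (Maybe; just; nothing)
open import Data.Maybe.Properties using (just-injective)
open import Data.Nat
open import Data.Nat.DivMod
open import Data.Nat.Divisibility using (m∣m*n)
open import Data.Nat.ListAction using (sum)
open import Data.Nat.Primality using (Prime; prime⇒nonZero; prime⇒nonTrivial)
open import Data.Nat.Properties
open import Data.Nat.Tactic.RingSolver using (solve-∀)
open import Data.Product using (∃; _×_; _,_; proj₁)
open import Relation.Binary.PropositionalEquality
open import Relation.Nullary using (Dec; yes; no; does; _×-dec_)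

∑ : {A : Set} → List A → (A → ℕ) → ℕ
∑ xs f = sum (map f xs)

-- Partitions are lists of parts; λ(n,i) = (n - i, 1^i).

Partition : Set
Partition = List ℕ

hook : (n i : ℕ) → Partition
hook n i = (n ∸ i) ∷ replicate i 1

-- B m n has m horizontal and n vertical nodes.

record Block : Set where
  constructor B
  field
    horizontal : ℕ
    vertical   : ℕ

open Block public

addBlock : Partition → Block → Partition
addBlock []      (B m n) = []
addBlock (r ∷ c) (B m n) = (r + m) ∷ (c ++ replicate n 1)

module _ (p : ℕ) (p-prime : Prime p) (k : ℕ) where

  private
    instance
      p-nonZero : NonZero p
      p-nonZero = prime⇒nonZero p-prime

      p^k-nonZero : NonZero (p ^ k)
      p^k-nonZero = m^n≢0 p k

  data Vertex : Set where
    S : Fin (p ^ k * (p ∸ 1)) → Vertex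
    V : (s : ℕ) .{{_ : NonZero s}} → Fin (p ^ k) → Vertex
    W : (s : ℕ) .{{_ : NonTrivial s}} → Fin (p ^ (k + 1)) → Vertex

  floor : Vertex → ℕ
  floor (S i)    = 2 * k + 1
  floor (V s l)  = 2 * (k + s)
  floor (W s l′) = 2 * (k + s) ∸ 1

  x : ℕ → ℕ
  x s = p ^ k * (s * p ∸ (s + 1))

  shape : Vertex → Partition
  shape (S i)    = hook (p ^ k * (p ∸ 1)) (toℕ i)
  shape (V s l)  = hook (p ^ k * (2 * s * p ∸ (2 * s + 1))) (x s + toℕ l)
  shape (W s l′) = hook (p ^ k * ((2 * s ∸ 1) * p ∸ 2 * s)) (x (s ∸ 1) + toℕ l′)

  data Edge : Vertex → Vertex → Set where
    e₁ : ∀ {i l} (t : Fin (p ∸ 1)) →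
         toℕ i ≡ p ^ k * toℕ t + toℕ l →
         Edge (S i) (V 1 l)
    e₂ : ∀ {s l l′} (β : Fin p) →
         toℕ l′ ≡ p * toℕ l + toℕ β →
         Edge (V (1 + s) l) (W (2 + s) l′)
    e₃ : ∀ {s l′ l} →
         toℕ l ≡ toℕ l′ ∸ p ^ k * (toℕ l′ / p ^ k) →
         Edge (W (2 + s) l′) (V (2 + s) l)

  block : ∀ {u v} → Edge u v → Block
  block (e₁ t _) = B (p ^ k * toℕ t) (p ^ k * (p ∸ 2 ∸ toℕ t))
  block (e₂ {l = l} β _) =
    B (p ^ k * (p ∸ 1) ∸ ((p ∸ 1) * toℕ l + toℕ β)) ((p ∸ 1) * toℕ l + toℕ β)
  block (e₃ {l′ = l′} _) = B (p ^ k * t) (p ^ k * (p ∸ 1 ∸ t))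
    where t = toℕ l′ / p ^ k

  infixl 5 _▷_

  data Path : Vertex → Set where
    start : ∀ i → Path (S i)
    _▷_   : ∀ {u v} → Path u → Edge u v → Path v

  -- The index N of the last block of a path; blocks are numbered from 2.

  top : ∀ {v} → Path v → ℕ
  top (start i) = 1
  top (P ▷ e)   = suc (top P)

  -- The block B^j. Outside 2 ≤ j ≤ N there is no such block and B 0 0 is a
  -- junk value, never inspected by the definition of descents below.

  blockAt : ∀ {v} → Path v → ℕ → Block
  blockAt (start i) j = B 0 0
  blockAt (P ▷ e)   j = if does (j ≟ top (P ▷ e)) then block e else blockAt P j

  -- IsDescent P j is j ∈ Des(P); for odd p the bound (p ∸ 1) / 2 is exact.

  IsDescent : ∀ {v} → Path v → ℕ → Set
  IsDescent P 0 = ⊥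
  IsDescent P 1 = 1 < top P ×
    ∃ λ (t : Fin ((p ∸ 1) / 2)) → horizontal (blockAt P 2) ≡ p ^ k * toℕ t
  IsDescent P 2 = ⊥
  IsDescent P j@(suc (suc (suc _))) = j < top P ×
    horizontal (blockAt P j) > horizontal (blockAt P (1 + j)) ×
    vertical (blockAt P j) < vertical (blockAt P (1 + j))

  isDescent? : ∀ {v} (P : Path v) j → Dec (IsDescent P j)
  isDescent? P 0 = no λ ()
  isDescent? P 1 = (1 <? top P) ×-dec any? (λ t → horizontal (blockAt P 2) ≟ p ^ k * toℕ t)
  isDescent? P 2 = no λ ()
  isDescent? P j@(suc (suc (suc _))) = (j <? top P) ×-dec
    ((horizontal (blockAt P (1 + j)) <? horizontal (blockAt P j)) ×-dec
     (vertical (blockAt P j) <? vertical (blockAt P (1 + j))))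

  des : ∀ {v} → Path v → ℕ
  des P = length (filter (isDescent? P) (upTo (top P)))

  -- 𝒫(v) as a list: inEdges v lists the edges into v, and every path to v has
  -- floor v - (2k+1) edges. Completeness and absence of repetitions are
  -- paths-complete and paths-unique at the end of this module.

  private
    p^[k+1]≡ : p * p ^ k ≡ p ^ (k + 1)
    p^[k+1]≡ = cong (p ^_) (+-comm 1 k)

    i-bound : (t : Fin (p ∸ 1)) (l : Fin (p ^ k)) → p ^ k * toℕ t + toℕ l < p ^ k * (p ∸ 1)
    i-bound t l = subst₂ _<_ (toℕ-combine t l) (*-comm (p ∸ 1) (p ^ k)) (toℕ<n (combine t l))

    l′-bound : (t : Fin p) (l : Fin (p ^ k)) → p ^ k * toℕ t + toℕ l < p ^ (k + 1)
    l′-bound t l = subst₂ _<_ (toℕ-combine t l) p^[k+1]≡ (toℕ<n (combine t l))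

    l-bound : (l′ : Fin (p ^ (k + 1))) → toℕ l′ / p < p ^ k
    l-bound l′ = m<n*o⇒m/o<n (subst (toℕ l′ <_) (trans (sym p^[k+1]≡) (*-comm p (p ^ k))) (toℕ<n l′))

    divMod-unique : ∀ q .{{_ : NonZero q}} t r → r < q → (q * t + r) / q ≡ t
    divMod-unique q t r r<q = begin
      (q * t + r) / q      ≡⟨ +-distrib-/-∣ˡ r (m∣m*n t) ⟩
      q * t / q + r / q    ≡⟨ cong₂ _+_ (trans (cong (_/ q) (*-comm q t)) (m*n/n≡m t q)) (m<n⇒m/n≡0 r<q) ⟩
      t + 0                ≡⟨ +-identityʳ t ⟩
      t ∎
      where open ≡-Reasoning

  sourceS : Fin (p ∸ 1) → Fin (p ^ k) → Fin (p ^ k * (p ∸ 1))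
  sourceS t l = fromℕ< (i-bound t l)

  sourceW : Fin p → Fin (p ^ k) → Fin (p ^ (k + 1))
  sourceW t l = fromℕ< (l′-bound t l)

  sourceV : Fin (p ^ (k + 1)) → Fin (p ^ k)
  sourceV l′ = fromℕ< (l-bound l′)

  private
    sourceW-/ : ∀ t l → toℕ (sourceW t l) / p ^ k ≡ toℕ t
    sourceW-/ t l = trans (cong (_/ p ^ k) (toℕ-fromℕ< (l′-bound t l)))
                          (divMod-unique (p ^ k) (toℕ t) (toℕ l) (toℕ<n l))

    sourceW-∸ : ∀ t l → toℕ l ≡ toℕ (sourceW t l) ∸ p ^ k * (toℕ (sourceW t l) / p ^ k)
    sourceW-∸ t l = sym (begin
      toℕ (sourceW t l) ∸ p ^ k * (toℕ (sourceW t l) / p ^ k)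
        ≡⟨ cong₂ (λ a b → a ∸ p ^ k * b) (toℕ-fromℕ< (l′-bound t l)) (sourceW-/ t l) ⟩
      p ^ k * toℕ t + toℕ l ∸ p ^ k * toℕ t
        ≡⟨ m+n∸m≡n (p ^ k * toℕ t) (toℕ l) ⟩
      toℕ l ∎)
      where open ≡-Reasoning

    sourceV-≡ : ∀ l′ → toℕ l′ ≡ p * toℕ (sourceV l′) + toℕ (toℕ l′ mod p)
    sourceV-≡ l′ = begin
      toℕ l′                             ≡⟨ m≡m%n+[m/n]*n (toℕ l′) p ⟩
      toℕ l′ % p + toℕ l′ / p * p        ≡⟨ +-comm (toℕ l′ % p) _ ⟩
      toℕ l′ / p * p + toℕ l′ % p        ≡⟨ cong₂ _+_ (*-comm (toℕ l′ / p) p) (sym (toℕ-fromℕ< (m%n<n (toℕ l′) p))) ⟩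
      p * (toℕ l′ / p) + toℕ (toℕ l′ mod p)
        ≡⟨ cong (λ a → p * a + toℕ (toℕ l′ mod p)) (sym (toℕ-fromℕ< (l-bound l′))) ⟩
      p * toℕ (sourceV l′) + toℕ (toℕ l′ mod p) ∎
      where open ≡-Reasoning

  inEdges : (v : Vertex) → List (∃ λ u → Edge u v)
  inEdges (S i) = []
  inEdges (V 1 l) =
    map (λ t → S (sourceS t l) , e₁ t (toℕ-fromℕ< (i-bound t l))) (allFin (p ∸ 1))
  inEdges (V (suc (suc s)) l) =
    map (λ t → W (2 + s) (sourceW t l) , e₃ (sourceW-∸ t l)) (allFin p)
  inEdges (W (suc (suc s)) l′) =
    (V (1 + s) (sourceV l′) , e₂ (toℕ l′ mod p) (sourceV-≡ l′)) ∷ []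

  pathsOfLength : ℕ → (v : Vertex) → List (Path v)
  pathsOfLength zero    (S i)   = start i ∷ []
  pathsOfLength zero    (V _ _) = []
  pathsOfLength zero    (W _ _) = []
  pathsOfLength (suc n) v =
    concatMap (λ (u , e) → map (_▷ e) (pathsOfLength n u)) (inEdges v)

  paths : (v : Vertex) → List (Path v)
  paths v = pathsOfLength (floor v ∸ (2 * k + 1)) v

  -- The p^k-Fibonacci number of a vertex.

  𝓜 : Vertex → ℕ
  𝓜 v = ∑ (paths v) des

  private
    sourceS-injective : ∀ {t t′} l → sourceS t l ≡ sourceS t′ l → t ≡ t′
    sourceS-injective {t} {t′} l eq = combine-injectiveˡ t l t′ l (toℕ-injective (begin
      toℕ (combine t l)         ≡⟨ toℕ-combine t l ⟩
      p ^ k * toℕ t + toℕ l     ≡⟨ toℕ-fromℕ< (i-bound t l) ⟨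
      toℕ (sourceS t l)         ≡⟨ cong toℕ eq ⟩
      toℕ (sourceS t′ l)        ≡⟨ toℕ-fromℕ< (i-bound t′ l) ⟩
      p ^ k * toℕ t′ + toℕ l    ≡⟨ toℕ-combine t′ l ⟨
      toℕ (combine t′ l)        ∎))
      where open ≡-Reasoning

    sourceW-injective : ∀ {t t′} l → sourceW t l ≡ sourceW t′ l → t ≡ t′
    sourceW-injective {t} {t′} l eq = toℕ-injective
      (trans (sym (sourceW-/ t l)) (trans (cong (λ j → toℕ j / p ^ k) eq) (sourceW-/ t′ l)))

    S-injective : ∀ {i j} → S i ≡ S j → i ≡ j
    S-injective refl = refl

    W-injective : ∀ {s i j} → W (2 + s) i ≡ W (2 + s) j → i ≡ j
    W-injective refl = refl

  inEdges-unique : ∀ v → Unique (inEdges v)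
  inEdges-unique (S i) = []
  inEdges-unique (V 1 l) =
    Unique.map⁺ (λ eq → sourceS-injective l (S-injective (cong proj₁ eq))) (Unique.allFin⁺ (p ∸ 1))
  inEdges-unique (V (suc (suc s)) l) =
    Unique.map⁺ (λ eq → sourceW-injective l (W-injective (cong proj₁ eq))) (Unique.allFin⁺ p)
  inEdges-unique (W (suc (suc s)) l′) = [] ∷ []

  private
    e₁-≡ : ∀ {i j l} t (eq : toℕ i ≡ p ^ k * toℕ t + toℕ l) (eq′ : toℕ j ≡ p ^ k * toℕ t + toℕ l) →
           _≡_ {A = ∃ λ u → Edge u (V 1 l)} (S i , e₁ t eq) (S j , e₁ t eq′)
    e₁-≡ t eq eq′ with refl ← toℕ-injective (trans eq (sym eq′))
      with refl ← ≡-irrelevant eq eq′ = refl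

    e₂-≡ : ∀ {s l m l′} β γ (eq : toℕ l′ ≡ p * toℕ l + toℕ β) (eq′ : toℕ l′ ≡ p * toℕ m + toℕ γ) →
           _≡_ {A = ∃ λ u → Edge u (W (2 + s) l′)} (V (1 + s) l , e₂ β eq) (V (1 + s) m , e₂ γ eq′)
    e₂-≡ {s} {l} {m} {l′} β γ eq eq′ =
      go (toℕ-injective (trans (sym (quot l β eq)) (quot m γ eq′))) eq eq′
      where
      quot : ∀ l (β : Fin p) → toℕ l′ ≡ p * toℕ {p ^ k} l + toℕ β → toℕ l′ / p ≡ toℕ l
      quot l β eq = trans (cong (_/ p) eq) (divMod-unique p (toℕ l) (toℕ β) (toℕ<n β))
      go : ∀ {l m} → l ≡ m → (eq : toℕ l′ ≡ p * toℕ l + toℕ β) (eq′ : toℕ l′ ≡ p * toℕ m + toℕ γ) →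
           _≡_ {A = ∃ λ u → Edge u (W (2 + s) l′)} (V (1 + s) l , e₂ β eq) (V (1 + s) m , e₂ γ eq′)
      go {l} refl eq eq′
        with refl ← toℕ-injective {i = β} {γ} (+-cancelˡ-≡ (p * toℕ l) _ _ (trans (sym eq) eq′))
        with refl ← ≡-irrelevant eq eq′ = refl

    e₃-≡ : ∀ {s i j l} (eq : toℕ l ≡ toℕ i ∸ p ^ k * (toℕ i / p ^ k))
           (eq′ : toℕ l ≡ toℕ j ∸ p ^ k * (toℕ j / p ^ k)) → i ≡ j →
           _≡_ {A = ∃ λ u → Edge u (V (2 + s) l)} (W (2 + s) i , e₃ eq) (W (2 + s) j , e₃ eq′)
    e₃-≡ eq eq′ refl with refl ← ≡-irrelevant eq eq′ = refl

    quotW : Fin (p ^ (k + 1)) → Fin p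
    quotW l′ = fromℕ< {toℕ l′ / p ^ k} (m<n*o⇒m/o<n (subst (toℕ l′ <_) (sym p^[k+1]≡) (toℕ<n l′)))

    toℕ-quotW : ∀ l′ → toℕ (quotW l′) ≡ toℕ l′ / p ^ k
    toℕ-quotW l′ = toℕ-fromℕ< (m<n*o⇒m/o<n (subst (toℕ l′ <_) (sym p^[k+1]≡) (toℕ<n l′)))

    W-decompose : ∀ {l′ : Fin (p ^ (k + 1))} {l : Fin (p ^ k)} →
                  toℕ l ≡ toℕ l′ ∸ p ^ k * (toℕ l′ / p ^ k) →
                  toℕ l′ ≡ p ^ k * (toℕ l′ / p ^ k) + toℕ l
    W-decompose {l′} {l} eq = sym (trans
      (cong (p ^ k * (toℕ l′ / p ^ k) +_) eq)
      (m+[n∸m]≡n (subst (_≤ toℕ l′) (*-comm (toℕ l′ / p ^ k) (p ^ k)) (m/n*n≤m (toℕ l′) (p ^ k)))))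

    sourceW-quotW : ∀ {l′ l} → toℕ l ≡ toℕ l′ ∸ p ^ k * (toℕ l′ / p ^ k) → l′ ≡ sourceW (quotW l′) l
    sourceW-quotW {l′} {l} eq = toℕ-injective (begin
      toℕ l′                                ≡⟨ W-decompose {l′} {l} eq ⟩
      p ^ k * (toℕ l′ / p ^ k) + toℕ l      ≡⟨ cong (λ a → p ^ k * a + toℕ l) (toℕ-quotW l′) ⟨
      p ^ k * toℕ (quotW l′) + toℕ l        ≡⟨ toℕ-fromℕ< (l′-bound (quotW l′) l) ⟨
      toℕ (sourceW (quotW l′) l)            ∎)
      where open ≡-Reasoning

  inEdges-complete : ∀ {u v} (e : Edge u v) → (u , e) ∈ inEdges v
  inEdges-complete (e₁ {l = l} t eq) =
    subst (_∈ inEdges (V 1 l)) (e₁-≡ t (toℕ-fromℕ< (i-bound t l)) eq) (∈-map⁺ _ (∈-allFin t))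
  inEdges-complete (e₂ {l′ = l′} β eq) = here (e₂-≡ β (toℕ l′ mod p) eq (sourceV-≡ l′))
  inEdges-complete (e₃ {s} {l′} {l} eq) =
    subst (_∈ inEdges (V (2 + s) l))
          (e₃-≡ (sourceW-∸ (quotW l′) l) eq (sym (sourceW-quotW eq)))
          (∈-map⁺ _ (∈-allFin (quotW l′)))

  edge-floor : ∀ {u v} → Edge u v → floor v ≡ suc (floor u)
  edge-floor (e₁ _ _)     = lemma k
    where
    lemma : ∀ k → 2 * (k + 1) ≡ suc (2 * k + 1)
    lemma = solve-∀
  edge-floor (e₂ {s} _ _) = cong (_∸ 1) (lemma k s)
    where
    lemma : ∀ k s → 2 * (k + (2 + s)) ≡ suc (suc (2 * (k + (1 + s))))
    lemma = solve-∀
  edge-floor (e₃ {s} _)   = sym (m+[n∸m]≡n {1} (≤-trans (m≤n⇒m≤o+n k (s≤s z≤n)) (m≤m+n (k + (2 + s)) _)))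

  private
    d g : ℕ
    d = p ∸ 1
    g = p ∸ 2

    p≥2 : 2 ≤ p
    p≥2 = nonTrivial⇒n>1 p {{prime⇒nonTrivial p-prime}}

    p≡1+d : p ≡ 1 + d
    p≡1+d = sym (m+[n∸m]≡n (<⇒≤ p≥2))

    d≡1+g : d ≡ 1 + g
    d≡1+g = +-∸-assoc 1 p≥2

    replicate-++ : ∀ m n → replicate (m + n) 1 ≡ replicate m 1 ++ replicate n 1
    replicate-++ zero    n = refl
    replicate-++ (suc m) n = cong (1 ∷_) (replicate-++ m n)

    hook-addBlock : ∀ n i a c {n′ i′} → i ≤ n → n′ ≡ n + (a + c) → i′ ≡ i + c →
                    hook n′ i′ ≡ addBlock (hook n i) (B a c)
    hook-addBlock n i a c i≤n refl refl = cong₂ _∷_ row (replicate-++ i c)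
      where
      open ≡-Reasoning
      row : n + (a + c) ∸ (i + c) ≡ n ∸ i + a
      row = begin
        n + (a + c) ∸ (i + c)    ≡⟨ cong₂ _∸_ (trans (sym (+-assoc n a c)) (+-comm (n + a) c)) (+-comm i c) ⟩
        c + (n + a) ∸ (c + i)    ≡⟨ [m+n]∸[m+o]≡n∸o c (n + a) i ⟩
        n + a ∸ i                ≡⟨ +-∸-comm a i≤n ⟩
        n ∸ i + a                ∎

    ∸-from : ∀ {m} n {o} → m ≡ n + o → m ∸ n ≡ o
    ∸-from n {o} refl = m+n∸m≡n n o

    x-closed : ∀ s → x (1 + s) ≡ p ^ k * (s * d + g)
    x-closed s = cong (p ^ k *_) (∸-from ((1 + s) + 1)
      (trans (cong ((1 + s) *_) (trans p≡1+d (cong suc d≡1+g)))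
        (trans (ring s g) (cong (λ y → (1 + s) + 1 + (s * y + g)) (sym d≡1+g)))))
      where
      ring : ∀ s g → (1 + s) * (2 + g) ≡ (1 + s) + 1 + (s * (1 + g) + g)
      ring = solve-∀

    V-size : ∀ s → p ^ k * (2 * (1 + s) * p ∸ (2 * (1 + s) + 1)) ≡ p ^ k * ((1 + 2 * s) * d + g)
    V-size s = cong (p ^ k *_) (∸-from (2 * (1 + s) + 1)
      (trans (cong (2 * (1 + s) *_) (trans p≡1+d (cong suc d≡1+g)))
        (trans (ring s g) (cong (λ y → 2 * (1 + s) + 1 + ((1 + 2 * s) * y + g)) (sym d≡1+g)))))
      where
      ring : ∀ s g → 2 * (1 + s) * (2 + g) ≡ 2 * (1 + s) + 1 + ((1 + 2 * s) * (1 + g) + g)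
      ring = solve-∀

    W-size : ∀ s → p ^ k * ((2 * (2 + s) ∸ 1) * p ∸ 2 * (2 + s)) ≡ p ^ k * ((2 + 2 * s) * d + g)
    W-size s = cong (p ^ k *_) (∸-from (2 * (2 + s))
      (trans (cong ((2 * (2 + s) ∸ 1) *_) (trans p≡1+d (cong suc d≡1+g)))
        (trans (ring s g) (cong (λ y → 2 * (2 + s) + ((2 + 2 * s) * y + g)) (sym d≡1+g)))))
      where
      ring : ∀ s g → (1 + s + (2 + s + 0)) * (2 + g) ≡ 2 * (2 + s) + ((2 + 2 * s) * (1 + g) + g)
      ring = solve-∀

    q≤qd : p ^ k ≤ p ^ k * d
    q≤qd = subst (λ y → p ^ k ≤ p ^ k * y) (sym d≡1+g) (m≤m*n (p ^ k) (1 + g))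

    split : ∀ {t y} → t ≤ y → p ^ k * y ≡ p ^ k * t + p ^ k * (y ∸ t)
    split {t} t≤y = trans (cong (p ^ k *_) (sym (m+[n∸m]≡n t≤y))) (*-distribˡ-+ (p ^ k) t _)

  edge-adds-block : ∀ {u v} (e : Edge u v) → shape v ≡ addBlock (shape u) (block e)
  edge-adds-block (e₁ {i} {l} t eq) = hook-addBlock _ _ _ _ (<⇒≤ (toℕ<n i)) size leg
    where
    open ≡-Reasoning
    t≤g : toℕ t ≤ g
    t≤g = ≤-pred (subst (toℕ t <_) d≡1+g (toℕ<n t))
    ring₁ : ∀ q d g → q * ((1 + 2 * 0) * d + g) ≡ q * d + q * g
    ring₁ = solve-∀
    ring₂ : ∀ a c l → a + c + l ≡ a + l + c
    ring₂ = solve-∀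
    size : p ^ k * (2 * 1 * p ∸ (2 * 1 + 1)) ≡ p ^ k * d + (p ^ k * toℕ t + p ^ k * (g ∸ toℕ t))
    size = trans (V-size 0) (trans (ring₁ (p ^ k) d g) (cong (p ^ k * d +_) (split t≤g)))
    leg : x 1 + toℕ l ≡ toℕ i + p ^ k * (g ∸ toℕ t)
    leg = begin
      x 1 + toℕ l                                       ≡⟨ cong (_+ toℕ l) (trans (x-closed 0) (split t≤g)) ⟩
      p ^ k * toℕ t + p ^ k * (g ∸ toℕ t) + toℕ l       ≡⟨ ring₂ (p ^ k * toℕ t) _ (toℕ l) ⟩
      p ^ k * toℕ t + toℕ l + p ^ k * (g ∸ toℕ t)       ≡⟨ cong (_+ p ^ k * (g ∸ toℕ t)) eq ⟨
      toℕ i + p ^ k * (g ∸ toℕ t)                       ∎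
  edge-adds-block (e₂ {s} {l} {l′} β eq) = hook-addBlock _ _ _ _ leg≤size size leg
    where
    c : ℕ
    c = d * toℕ l + toℕ β
    c≤ : c ≤ p ^ k * d
    c≤ = begin
      d * toℕ l + toℕ β    ≤⟨ +-monoʳ-≤ (d * toℕ l) (≤-pred (subst (toℕ β <_) p≡1+d (toℕ<n β))) ⟩
      d * toℕ l + d        ≡⟨ trans (+-comm _ d) (sym (*-suc d (toℕ l))) ⟩
      d * suc (toℕ l)      ≤⟨ *-monoʳ-≤ d (toℕ<n l) ⟩
      d * p ^ k            ≡⟨ *-comm d (p ^ k) ⟩
      p ^ k * d            ∎
      where open ≤-Reasoning
    ring₁ : ∀ q s d g → q * ((2 + 2 * s) * d + g) ≡ q * ((1 + 2 * s) * d + g) + q * d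
    ring₁ = solve-∀
    ring₂ : ∀ q s d g → q * (s * d + g) + q * d + q * (s * d) ≡ q * ((1 + 2 * s) * d + g)
    ring₂ = solve-∀
    ring₃ : ∀ d l β y → y + ((1 + d) * l + β) ≡ y + l + (d * l + β)
    ring₃ = solve-∀
    leg≤size : x (1 + s) + toℕ l ≤ p ^ k * (2 * (1 + s) * p ∸ (2 * (1 + s) + 1))
    leg≤size = begin
      x (1 + s) + toℕ l                                  ≤⟨ +-mono-≤ (≤-reflexive (x-closed s)) (≤-trans (<⇒≤ (toℕ<n l)) q≤qd) ⟩
      p ^ k * (s * d + g) + p ^ k * d                    ≤⟨ m≤m+n _ (p ^ k * (s * d)) ⟩
      p ^ k * (s * d + g) + p ^ k * d + p ^ k * (s * d)  ≡⟨ ring₂ (p ^ k) s d g ⟩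
      p ^ k * ((1 + 2 * s) * d + g)                      ≡⟨ V-size s ⟨
      p ^ k * (2 * (1 + s) * p ∸ (2 * (1 + s) + 1))      ∎
      where open ≤-Reasoning
    size : p ^ k * ((2 * (2 + s) ∸ 1) * p ∸ 2 * (2 + s)) ≡
           p ^ k * (2 * (1 + s) * p ∸ (2 * (1 + s) + 1)) + (p ^ k * d ∸ c + c)
    size = trans (W-size s) (trans (ring₁ (p ^ k) s d g) (cong₂ _+_ (sym (V-size s)) (sym (m∸n+n≡m c≤))))
    leg : x (1 + s) + toℕ l′ ≡ x (1 + s) + toℕ l + c
    leg = trans (cong (x (1 + s) +_) (trans eq (cong (λ y → y * toℕ l + toℕ β) p≡1+d)))
                (ring₃ d (toℕ l) (toℕ β) (x (1 + s)))
  edge-adds-block (e₃ {s} {l′} {l} eq) = hook-addBlock _ _ _ _ leg≤size size leg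
    where
    t : ℕ
    t = toℕ l′ / p ^ k
    t≤d : t ≤ d
    t≤d = ≤-pred (subst₂ _<_ (toℕ-quotW l′) p≡1+d (toℕ<n (quotW l′)))
    ring₁ : ∀ q s d g → q * ((1 + 2 * (1 + s)) * d + g) ≡ q * ((2 + 2 * s) * d + g) + q * d
    ring₁ = solve-∀
    ring₂ : ∀ q s d g → q * (s * d + g) + (q * d + q * d) + q * (s * d) ≡ q * ((2 + 2 * s) * d + g)
    ring₂ = solve-∀
    ring₃ : ∀ q s d g l → q * ((1 + s) * d + g) + l ≡ q * (s * d + g) + l + q * d
    ring₃ = solve-∀
    ring₄ : ∀ y l a c → y + l + (a + c) ≡ y + (a + l) + c
    ring₄ = solve-∀
    l′≤ : toℕ l′ ≤ p ^ k * d + p ^ k * d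
    l′≤ = begin
      toℕ l′                       ≤⟨ <⇒≤ (toℕ<n l′) ⟩
      p ^ (k + 1)                  ≡⟨ p^[k+1]≡ ⟨
      p * p ^ k                    ≡⟨ cong (_* p ^ k) p≡1+d ⟩
      p ^ k + d * p ^ k            ≤⟨ +-mono-≤ q≤qd (≤-reflexive (*-comm d (p ^ k))) ⟩
      p ^ k * d + p ^ k * d        ∎
      where open ≤-Reasoning
    leg≤size : x (1 + s) + toℕ l′ ≤ p ^ k * ((2 * (2 + s) ∸ 1) * p ∸ 2 * (2 + s))
    leg≤size = begin
      x (1 + s) + toℕ l′                                             ≤⟨ +-mono-≤ (≤-reflexive (x-closed s)) l′≤ ⟩
      p ^ k * (s * d + g) + (p ^ k * d + p ^ k * d)                  ≤⟨ m≤m+n _ (p ^ k * (s * d)) ⟩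
      p ^ k * (s * d + g) + (p ^ k * d + p ^ k * d) + p ^ k * (s * d) ≡⟨ ring₂ (p ^ k) s d g ⟩
      p ^ k * ((2 + 2 * s) * d + g)                                  ≡⟨ W-size s ⟨
      p ^ k * ((2 * (2 + s) ∸ 1) * p ∸ 2 * (2 + s))                  ∎
      where open ≤-Reasoning
    size : p ^ k * (2 * (2 + s) * p ∸ (2 * (2 + s) + 1)) ≡
           p ^ k * ((2 * (2 + s) ∸ 1) * p ∸ 2 * (2 + s)) + (p ^ k * t + p ^ k * (d ∸ t))
    size = trans (V-size (1 + s)) (trans (ring₁ (p ^ k) s d g) (cong₂ _+_ (sym (W-size s)) (split t≤d)))
    leg : x (2 + s) + toℕ l ≡ x (1 + s) + toℕ l′ + p ^ k * (d ∸ t)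
    leg = begin
      x (2 + s) + toℕ l                                        ≡⟨ cong (_+ toℕ l) (x-closed (1 + s)) ⟩
      p ^ k * ((1 + s) * d + g) + toℕ l                        ≡⟨ ring₃ (p ^ k) s d g (toℕ l) ⟩
      p ^ k * (s * d + g) + toℕ l + p ^ k * d                  ≡⟨ cong₂ (λ y z → y + toℕ l + z) (sym (x-closed s)) (split t≤d) ⟩
      x (1 + s) + toℕ l + (p ^ k * t + p ^ k * (d ∸ t))        ≡⟨ ring₄ (x (1 + s)) (toℕ l) (p ^ k * t) _ ⟩
      x (1 + s) + (p ^ k * t + toℕ l) + p ^ k * (d ∸ t)        ≡⟨ cong (λ y → x (1 + s) + y + p ^ k * (d ∸ t)) (W-decompose {l′} {l} eq) ⟨
      x (1 + s) + toℕ l′ + p ^ k * (d ∸ t)                     ∎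
      where open ≡-Reasoning

  private
    lengthOf : ∀ {v} → Path v → ℕ
    lengthOf (start i) = 0
    lengthOf (P ▷ e)   = suc (lengthOf P)

    floor-length : ∀ {v} (P : Path v) → floor v ≡ lengthOf P + (2 * k + 1)
    floor-length (start i) = refl
    floor-length (P ▷ e)   = trans (edge-floor e) (cong suc (floor-length P))

    pathsOfLength-complete : ∀ {v} (P : Path v) → P ∈ pathsOfLength (lengthOf P) v
    pathsOfLength-complete (start i) = here refl
    pathsOfLength-complete (P ▷ e)   =
      ∈-concatMap⁺ _ (lose (inEdges-complete e) (∈-map⁺ (_▷ e) (pathsOfLength-complete P)))

    ▷-injective : ∀ {u v} {e : Edge u v} {P Q : Path u} → P ▷ e ≡ Q ▷ e → P ≡ Q
    ▷-injective refl = refl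

    lastEdge : ∀ {v} → Path v → Maybe (∃ λ u → Edge u v)
    lastEdge (start i)       = nothing
    lastEdge (_▷_ {u} P e)   = just (u , e)

    pathsOfLength-unique : ∀ n v → Unique (pathsOfLength n v)
    pathsOfLength-unique zero (S i)   = [] ∷ []
    pathsOfLength-unique zero (V _ _) = []
    pathsOfLength-unique zero (W _ _) = []
    pathsOfLength-unique (suc n) v = Unique.concat⁺
      (All.map⁺ (All.universal (λ (u , e) → Unique.map⁺ ▷-injective (pathsOfLength-unique n u)) (inEdges v)))
      (AllPairs.map⁺ (AllPairs.map disjoint (inEdges-unique v)))
      where
      disjoint : ∀ {a b : ∃ λ u → Edge u v} → a ≢ b → ∀ {P : Path v} →
                 (P ∈ (let (u , e) = a in map (_▷ e) (pathsOfLength n u))) ×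
                 (P ∈ (let (u , e) = b in map (_▷ e) (pathsOfLength n u))) → ⊥
      disjoint a≢b (P∈a , P∈b) with ∈-map⁻ _ P∈a | ∈-map⁻ _ P∈b
      ... | _ , _ , eq | _ , _ , eq′ = a≢b (just-injective (cong lastEdge (trans (sym eq) eq′)))

  paths-complete : ∀ {v} (P : Path v) → P ∈ paths v
  paths-complete {v} P = subst (λ n → P ∈ pathsOfLength n v)
    (sym (trans (cong (_∸ (2 * k + 1)) (floor-length P)) (m+n∸n≡m (lengthOf P) (2 * k + 1))))
    (pathsOfLength-complete P)

  paths-unique : ∀ v → Unique (paths v)
  paths-unique v = pathsOfLength-unique (floor v ∸ (2 * k + 1)) v

-- The indices 0 ≤ t ≤ p - 1 of V_{s,t} when k = 1.

index₁ : ∀ {p} → Fin p → Fin (p ^ 1)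
index₁ {p} = cast (sym (^-identityʳ p))

b : (p s t : ℕ) → ℕ
b p s t = if does (t <? (p ∸ 1) / 2)
  then p ^ (s ∸ 1) * (p ∸ 1) * (p ^ 2 + p + t)
  else p ^ (s ∸ 1) * (p ∸ 1) * (p ^ 2 + t)

{-# OPTIONS --safe #-}

-- From B³ on, appending an edge to a path changes des only by the comparison of
-- the two last blocks. Away from B² every block has p^k(p-1) nodes, so that
-- comparison is a single inequality between residues, independent of the rest of
-- the path, and every vertex V_{s,l} is reached by (p-1)p^{s-1} paths. Summing over
-- all paths expresses 𝓜 at level s+1 through 𝓜 at level s: with h = (p-1)/2, s ≥ 2,
--   k = 0:  𝓜_{s+1} = p 𝓜_s + (p-1)²p^{s-1},
--   k = 1:  𝓜_{s+1,t} = Σ_u 𝓜_{s,u} + (p-1)p^{s-2}(ph+t) + (p-1)p^{s-1}(h+[t<h]).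
-- Applying this first-order recurrence at two consecutive levels gives the theorem.

module Submission where

open import Data.Bool using (true; false; if_then_else_)
open import Data.Fin using (Fin; zero; suc; toℕ; combine)
open import Data.Fin.Properties using (toℕ<n; toℕ-cast; toℕ-combine; toℕ-fromℕ<; toℕ-injective)
open import Data.List using (List; []; _∷_; _++_; allFin; applyUpTo; concatMap; filter; length; map; tabulate; upTo)
open import Data.List.Properties using (filter-++; filter-all; length-++; length-tabulate; map-++; map-cong; map-tabulate; map-upTo; map-∘; upTo-∷ʳ)
open import Data.List.Relation.Unary.All.Properties using (tabulate⁺)
open import Data.Nat
open import Data.Nat.DivMod
open import Data.Nat.Divisibility using (_∣_; m∣m*n; m%n≡0⇒n∣m)
open import Data.Nat.ListAction using (sum)
open import Data.Nat.ListAction.Properties using (sum-++)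
open import Data.Nat.Primality using (Prime; prime⇒nonZero; ¬prime[1])
open import Data.Nat.Properties
open import Data.Nat.Tactic.RingSolver using (solve-∀)
open import Data.Product using (∃; _×_; _,_; proj₂)
open import Function.Base using (_∘_; id)
open import Function.Bundles using (_⇔_; mk⇔; Equivalence)
open import Relation.Binary.PropositionalEquality
open import Relation.Nullary using (¬_; Dec; yes; no; does; contradiction; _×-dec_)
open import Relation.Nullary.Decidable using (does-⇔; dec-true; dec-false)
open import Defs

-- Indicators and finite sums

⟦_⟧ : {A : Set} → Dec A → ℕ
⟦ a? ⟧ = if does a? then 1 else 0

⟦⟧-cong : {A C : Set} → A ⇔ C → (a? : Dec A) (c? : Dec C) → ⟦ a? ⟧ ≡ ⟦ c? ⟧
⟦⟧-cong A⇔C a? c? = cong (if_then 1 else 0) (does-⇔ A⇔C a? c?)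

⟦⟧-yes : {A : Set} (a? : Dec A) → A → ⟦ a? ⟧ ≡ 1
⟦⟧-yes a? a = cong (if_then 1 else 0) (dec-true a? a)

⟦⟧-no : {A : Set} (a? : Dec A) → ¬ A → ⟦ a? ⟧ ≡ 0
⟦⟧-no a? ¬a = cong (if_then 1 else 0) (dec-false a? ¬a)

module _ {A : Set} where

  ∑-cong : ∀ {f g : A → ℕ} → (∀ a → f a ≡ g a) → ∀ xs → ∑ xs f ≡ ∑ xs g
  ∑-cong f≗g xs = cong sum (map-cong f≗g xs)

  ∑-++ : ∀ xs ys (f : A → ℕ) → ∑ (xs ++ ys) f ≡ ∑ xs f + ∑ ys f
  ∑-++ xs ys f = trans (cong sum (map-++ f xs ys)) (sum-++ (map f xs) (map f ys))

  ∑-+ : ∀ xs (f g : A → ℕ) → ∑ xs (λ a → f a + g a) ≡ ∑ xs f + ∑ xs g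
  ∑-+ []       f g = refl
  ∑-+ (a ∷ xs) f g = trans (cong (f a + g a +_) (∑-+ xs f g)) (interchange (f a) (g a) (∑ xs f) (∑ xs g))
    where
    interchange : ∀ m n o q → m + n + (o + q) ≡ m + o + (n + q)
    interchange = solve-∀

  ∑-*ˡ : ∀ c xs (f : A → ℕ) → ∑ xs (λ a → c * f a) ≡ c * ∑ xs f
  ∑-*ˡ c []       f = sym (*-zeroʳ c)
  ∑-*ˡ c (a ∷ xs) f = trans (cong (c * f a +_) (∑-*ˡ c xs f)) (sym (*-distribˡ-+ c (f a) (∑ xs f)))

  ∑-const : ∀ (xs : List A) c → ∑ xs (λ _ → c) ≡ length xs * c
  ∑-const []       c = refl
  ∑-const (_ ∷ xs) c = cong (c +_) (∑-const xs c)

  ∑-map : {C : Set} (g : C → A) (xs : List C) (f : A → ℕ) → ∑ (map g xs) f ≡ ∑ xs (f ∘ g)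
  ∑-map g xs f = cong sum (sym (map-∘ xs))

  ∑-concatMap : {C : Set} (g : C → List A) (xs : List C) (f : A → ℕ) →
                ∑ (concatMap g xs) f ≡ ∑ xs (λ c → ∑ (g c) f)
  ∑-concatMap g []       f = refl
  ∑-concatMap g (c ∷ xs) f = trans (∑-++ (g c) (concatMap g xs) f) (cong (∑ (g c) f +_) (∑-concatMap g xs f))

∑-allFin : ∀ n (f : ℕ → ℕ) → ∑ (allFin n) (f ∘ toℕ) ≡ ∑ (upTo n) f
∑-allFin n f = cong sum (trans (map-tabulate id (f ∘ toℕ)) (trans (tabulate-toℕ n f) (sym (map-upTo f n))))
  where
  tabulate-toℕ : ∀ n (f : ℕ → ℕ) → tabulate {n = n} (f ∘ toℕ) ≡ applyUpTo f n
  tabulate-toℕ zero    f = refl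
  tabulate-toℕ (suc n) f = cong (f 0 ∷_) (tabulate-toℕ n (f ∘ suc))

∑-upTo-suc : ∀ n (f : ℕ → ℕ) → ∑ (upTo (suc n)) f ≡ ∑ (upTo n) f + f n
∑-upTo-suc n f = begin
  ∑ (upTo (suc n)) f         ≡⟨ cong (λ xs → ∑ xs f) (upTo-∷ʳ n) ⟨
  ∑ (upTo n ++ n ∷ []) f     ≡⟨ ∑-++ (upTo n) (n ∷ []) f ⟩
  ∑ (upTo n) f + (f n + 0)   ≡⟨ cong (∑ (upTo n) f +_) (+-identityʳ (f n)) ⟩
  ∑ (upTo n) f + f n         ∎
  where open ≡-Reasoning

∑-allFin-const : ∀ n c → ∑ (allFin n) (λ _ → c) ≡ n * c
∑-allFin-const n c = trans (∑-const (allFin n) c) (cong (_* c) (length-tabulate {n = n} id))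

-- For `k = 1` the middle sum of the theorem omits the index 0, while the first-order recurrence
-- sums over all indices. The filter rejects `zero` by computation and keeps every successor.
∑-filter-positive : ∀ {n} (f : Fin (suc n) → ℕ) →
  ∑ (allFin (suc n)) f ≡ f zero + ∑ (filter (λ i → 1 ≤? toℕ i) (allFin (suc n))) f
∑-filter-positive {n} f = cong (λ xs → f zero + ∑ xs f) 
  (sym (filter-all (λ i → 1 ≤? toℕ i) {tabulate suc} (tabulate⁺ (λ _ → s≤s z≤n))))

∑-upTo-< : ∀ {m} n → m ≤ n → ∑ (upTo n) (λ i → ⟦ i <? m ⟧) ≡ m
∑-upTo-< {m} n m≤n = trans (go n) (m≤n⇒m⊓n≡m m≤n)
  where
  step : ∀ n → m ⊓ n + ⟦ n <? m ⟧ ≡ m ⊓ suc n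
  step n with n <? m
  ... | yes n<m = trans (cong₂ _+_ (m≥n⇒m⊓n≡n (<⇒≤ n<m)) (⟦⟧-yes (n <? m) n<m)) (trans (+-comm n 1) (sym (m≥n⇒m⊓n≡n n<m)))
  ... | no  n≮m = trans (cong₂ _+_ (m≤n⇒m⊓n≡m m≤n′) (⟦⟧-no (n <? m) n≮m)) (trans (+-identityʳ m) (sym (m≤n⇒m⊓n≡m (m≤n⇒m≤1+n m≤n′))))
    where m≤n′ = ≮⇒≥ n≮m
  -- Without the bound `m ≤ n` the count is the minimum, which makes the induction on the length go
  -- through.
  go : ∀ n → ∑ (upTo n) (λ i → ⟦ i <? m ⟧) ≡ m ⊓ n
  go zero    = sym (⊓-zeroʳ m)
  go (suc n) = trans (∑-upTo-suc n _) (trans (cong (_+ ⟦ n <? m ⟧) (go n)) (step n))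

∑-upTo-≤+ : ∀ {m} n → m ≤ n → ∑ (upTo n) (λ i → ⟦ n ≤? i + m ⟧) ≡ m
∑-upTo-≤+ {m} n m≤n = trans (go n) (m+n∸m≡n n m)
  where
  step : ∀ j → j + m ∸ n + ⟦ n ≤? j + m ⟧ ≡ suc j + m ∸ n
  step j with n ≤? j + m
  ... | yes n≤j+m = trans (cong (j + m ∸ n +_) (⟦⟧-yes (n ≤? j + m) n≤j+m)) (trans (+-comm _ 1) (sym (+-∸-assoc 1 n≤j+m)))
  ... | no  n≰j+m = trans (cong₂ _+_ (m≤n⇒m∸n≡0 (<⇒≤ j+m<n)) (⟦⟧-no (n ≤? j + m) n≰j+m)) (sym (m≤n⇒m∸n≡0 j+m<n))
    where j+m<n = ≰⇒> n≰j+m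
  -- The threshold `n` stays fixed while the range grows; truncated subtraction gives 0 until
  -- `j + m` passes `n`.
  go : ∀ j → ∑ (upTo j) (λ i → ⟦ n ≤? i + m ⟧) ≡ j + m ∸ n
  go zero    = sym (m≤n⇒m∸n≡0 m≤n)
  go (suc j) = trans (∑-upTo-suc j _) (trans (cong (_+ ⟦ n ≤? j + m ⟧) (go j)) (step j))

∑-upTo-id : ∀ h → ∑ (upTo (1 + 2 * h)) id ≡ (1 + 2 * h) * h
∑-upTo-id h = *-cancelˡ-≡ _ _ 2 (+-cancelʳ-≡ (1 + 2 * h) _ _ (trans (go (1 + 2 * h)) (ring h)))
  where
  ring : ∀ h → (1 + 2 * h) * (1 + 2 * h) ≡ 2 * ((1 + 2 * h) * h) + (1 + 2 * h)
  ring = solve-∀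
  ring′ : ∀ a n → 2 * (a + n) + suc n ≡ 2 * a + n + (n + suc n)
  ring′ = solve-∀
  ring″ : ∀ n → n * n + (n + suc n) ≡ suc n * suc n
  ring″ = solve-∀
  -- Doubling and adding `n` keeps Gauss's formula free of division and subtraction.
  go : ∀ n → 2 * ∑ (upTo n) id + n ≡ n * n
  go zero    = refl
  go (suc n) = begin
    2 * ∑ (upTo (suc n)) id + suc n       ≡⟨ cong (λ a → 2 * a + suc n) (∑-upTo-suc n id) ⟩
    2 * (∑ (upTo n) id + n) + suc n       ≡⟨ ring′ (∑ (upTo n) id) n ⟩
    2 * ∑ (upTo n) id + n + (n + suc n)   ≡⟨ cong (_+ (n + suc n)) (go n) ⟩
    n * n + (n + suc n)                   ≡⟨ ring″ n ⟩
    suc n * suc n                         ∎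
    where open ≡-Reasoning

-- Appending an edge raises `top` by one, so `des` gains exactly one new candidate index, the last
-- one.
count-upTo-suc : {P : ℕ → Set} (P? : ∀ j → Dec (P j)) (n : ℕ) →
                 length (filter P? (upTo (suc n))) ≡ length (filter P? (upTo n)) + ⟦ P? n ⟧
count-upTo-suc P? n = begin
  length (filter P? (upTo (suc n)))                              ≡⟨ cong (length ∘ filter P?) (upTo-∷ʳ n) ⟨
  length (filter P? (upTo n ++ n ∷ []))                          ≡⟨ cong length (filter-++ P? (upTo n) (n ∷ [])) ⟩
  length (filter P? (upTo n) ++ filter P? (n ∷ []))              ≡⟨ length-++ (filter P? (upTo n)) ⟩
  length (filter P? (upTo n)) + length (filter P? (n ∷ []))      ≡⟨ cong (length (filter P? (upTo n)) +_) last ⟩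
  length (filter P? (upTo n)) + ⟦ P? n ⟧                         ∎
  where
  open ≡-Reasoning
  last : length (filter P? (n ∷ [])) ≡ ⟦ P? n ⟧
  last with does (P? n)
  ... | true  = refl
  ... | false = refl

count-upTo-cong : {P Q : ℕ → Set} (P? : ∀ j → Dec (P j)) (Q? : ∀ j → Dec (Q j)) (n : ℕ) →
                  (∀ j → j < n → P j ⇔ Q j) →
                  length (filter P? (upTo n)) ≡ length (filter Q? (upTo n))
count-upTo-cong P? Q? zero    P⇔Q = refl
count-upTo-cong P? Q? (suc n) P⇔Q = begin
  length (filter P? (upTo (suc n)))          ≡⟨ count-upTo-suc P? n ⟩
  length (filter P? (upTo n)) + ⟦ P? n ⟧     ≡⟨ cong₂ _+_ (count-upTo-cong P? Q? n (λ j j<n → P⇔Q j (m<n⇒m<1+n j<n)))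
                                                          (⟦⟧-cong (P⇔Q n ≤-refl) (P? n) (Q? n)) ⟩
  length (filter Q? (upTo n)) + ⟦ Q? n ⟧     ≡⟨ count-upTo-suc Q? n ⟨
  length (filter Q? (upTo (suc n)))          ∎
  where open ≡-Reasoning

-- Descents between consecutive blocks

-- This has the same form as the block comparison inside `isDescent?`, so the two agree
-- definitionally in `IsDescent-top`.
isDrop? : (B₁ B₂ : Block) → Dec (horizontal B₁ > horizontal B₂ × vertical B₁ < vertical B₂)
isDrop? B₁ B₂ = (horizontal B₂ <? horizontal B₁) ×-dec (vertical B₁ <? vertical B₂)

descent : Block → Block → ℕ
descent B₁ B₂ = ⟦ isDrop? B₁ B₂ ⟧

m<n∸o⇔m+o<n : ∀ {m n} o → o ≤ n → (m < n ∸ o) ⇔ (m + o < n)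
m<n∸o⇔m+o<n {m} {n} o o≤n = mk⇔
  (λ m<n∸o → subst (m + o <_) (m∸n+n≡m o≤n) (+-monoˡ-< o m<n∸o))
  (m+n≤o⇒m≤o∸n (suc m))

n∸o<m⇔n<m+o : ∀ {m n} o → o ≤ n → (n ∸ o < m) ⇔ (n < m + o)
n∸o<m⇔n<m+o {m} {n} o o≤n = mk⇔
  (λ n∸o<m → subst (_< m + o) (m∸n+n≡m o≤n) (+-monoˡ-< o n∸o<m))
  (λ n<m+o → +-cancelʳ-< o _ _ (subst (_< m + o) (sym (m∸n+n≡m o≤n)) n<m+o))

open Equivalence

-- For blocks with the same number of nodes, the two inequalities defining a
-- descent amount to a single one.

descent-< : ∀ {q a c} → a ≤ q → c ≤ q → descent (B (q ∸ c) c) (B a (q ∸ a)) ≡ ⟦ a + c <? q ⟧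
descent-< {q} {a} {c} a≤q c≤q = ⟦⟧-cong (mk⇔
  (λ (a<q∸c , _) → to (m<n∸o⇔m+o<n c c≤q) a<q∸c)
  (λ a+c<q → from (m<n∸o⇔m+o<n c c≤q) a+c<q ,
             from (m<n∸o⇔m+o<n a a≤q) (subst (_< q) (+-comm a c) a+c<q)))
  ((a <? q ∸ c) ×-dec (c <? q ∸ a)) (a + c <? q)

-- Here the (E3) block comes first and the (E2) block second, so the comparison with `q` is reversed
-- relative to `descent-<`.
descent-> : ∀ {q a c} → a ≤ q → c ≤ q → descent (B a (q ∸ a)) (B (q ∸ c) c) ≡ ⟦ q <? a + c ⟧
descent-> {q} {a} {c} a≤q c≤q = ⟦⟧-cong (mk⇔
  (λ (q∸c<a , _) → to (n∸o<m⇔n<m+o c c≤q) q∸c<a)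
  (λ q<a+c → from (n∸o<m⇔n<m+o c c≤q) q<a+c ,
             from (n∸o<m⇔n<m+o a a≤q) (subst (q <_) (+-comm a c) q<a+c)))
  ((q ∸ c <? a) ×-dec (q ∸ a <? c)) (q <? a + c)

[q*t+r]/q≡t : ∀ q .{{_ : NonZero q}} t {r} → r < q → (q * t + r) / q ≡ t
[q*t+r]/q≡t q t {r} r<q = begin
  (q * t + r) / q      ≡⟨ +-distrib-/-∣ˡ r (m∣m*n t) ⟩
  q * t / q + r / q    ≡⟨ cong₂ _+_ (trans (cong (_/ q) (*-comm q t)) (m*n/n≡m t q)) (m<n⇒m/n≡0 r<q) ⟩
  t + 0                ≡⟨ +-identityʳ t ⟩
  t                    ∎
  where open ≡-Reasoning

-- Descents and sums over paths for arbitrary k.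

module _ (p : ℕ) (p-prime : Prime p) (k : ℕ) where

  private
    instance
      p-nonZero : NonZero p
      p-nonZero = prime⇒nonZero p-prime

      p^k-nonZero : NonZero (p ^ k)
      p^k-nonZero = m^n≢0 p k

    Vx : Set
    Vx = Vertex p p-prime k

    variable
      s : ℕ
      u v : Vx
      l : Fin (p ^ k)
      l′ : Fin (p ^ (k + 1))

    P[_] : Vx → Set
    P[_] = Path p p-prime k

    E[_,_] : Vx → Vx → Set
    E[_,_] = Edge p p-prime k

    top′ : P[ v ] → ℕ
    top′ = top p p-prime k

    des′ : P[ v ] → ℕ
    des′ = des p p-prime k

    blockAt′ : P[ v ] → ℕ → Block
    blockAt′ = blockAt p p-prime k

    block′ : E[ u , v ] → Block
    block′ = block p p-prime k

    pathsOfLength′ : ℕ → (v : Vx) → List P[ v ]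
    pathsOfLength′ = pathsOfLength p p-prime k

    src : Fin p → Fin (p ^ k) → Fin (p ^ (k + 1))
    src = sourceW p p-prime k

    srcV : Fin (p ^ (k + 1)) → Fin (p ^ k)
    srcV = sourceV p p-prime k

  blockAt-▷ : (P : P[ u ]) (e : E[ u , v ]) {j : ℕ} → j ≤ top′ P → blockAt′ (P ▷ e) j ≡ blockAt′ P j
  blockAt-▷ P e {j} j≤top =
    cong (if_then block′ e else blockAt′ P j) (dec-false (j ≟ suc (top′ P)) (<⇒≢ (s≤s j≤top)))

  blockAt-top : (P : P[ u ]) (e : E[ u , v ]) → blockAt′ (P ▷ e) (suc (top′ P)) ≡ block′ e
  blockAt-top P e =
    cong (if_then block′ e else blockAt′ P (suc (top′ P))) (dec-true (suc (top′ P) ≟ suc (top′ P)) refl)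

  -- Below `top′ P` only blocks of `P` itself are compared, and `blockAt-▷` shows that these are
  -- unchanged.
  IsDescent-▷ : (P : P[ u ]) (e : E[ u , v ]) (j : ℕ) → j < top′ P →
                IsDescent p p-prime k (P ▷ e) j ⇔ IsDescent p p-prime k P j
  IsDescent-▷ P e 0 j<top = mk⇔ (λ ()) (λ ())
  IsDescent-▷ P e 1 j<top rewrite blockAt-▷ P e j<top =
    mk⇔ (λ (_ , d) → j<top , d) (λ (_ , d) → m<n⇒m<1+n j<top , d)
  IsDescent-▷ P e 2 j<top = mk⇔ (λ ()) (λ ())
  IsDescent-▷ P e j@(suc (suc (suc _))) j<top rewrite blockAt-▷ P e j<top | blockAt-▷ P e (<⇒≤ j<top) =
    mk⇔ (λ (_ , d) → j<top , d) (λ (_ , d) → m<n⇒m<1+n j<top , d)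

  -- The old last index now has a successor block, that of `e`. The index is a separate variable `j`
  -- so that matching on it exposes the general clause of `IsDescent`; indices 1 and 2 follow
  -- special rules.
  IsDescent-top : (P : P[ u ]) (e : E[ u , v ]) (j : ℕ) → j ≡ top′ P → 3 ≤ j →
                  ⟦ isDescent? p p-prime k (P ▷ e) j ⟧ ≡ descent (blockAt′ P (top′ P)) (block′ e)
  IsDescent-top P e j@(suc (suc (suc _))) j≡top _ = begin
    ⟦ (j <? suc (top′ P)) ×-dec drop? ⟧
      ≡⟨ ⟦⟧-cong (mk⇔ proj₂ (s≤s (≤-reflexive j≡top) ,_)) ((j <? suc (top′ P)) ×-dec drop?) drop? ⟩
    descent (blockAt′ (P ▷ e) j) (blockAt′ (P ▷ e) (1 + j))
      ≡⟨ cong₂ descent (trans (blockAt-▷ P e (≤-reflexive j≡top)) (cong (blockAt′ P) j≡top))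
                       (trans (cong (blockAt′ (P ▷ e) ∘ suc) j≡top) (blockAt-top P e)) ⟩
    descent (blockAt′ P (top′ P)) (block′ e) ∎
    where
    open ≡-Reasoning
    drop? = isDrop? (blockAt′ (P ▷ e) j) (blockAt′ (P ▷ e) (1 + j))
  IsDescent-top P e 1 j≡top (s≤s ())
  IsDescent-top P e 2 j≡top (s≤s (s≤s ()))

  des-▷ : (P : P[ u ]) (e : E[ u , v ]) → 3 ≤ top′ P →
          des′ (P ▷ e) ≡ des′ P + descent (blockAt′ P (top′ P)) (block′ e)
  des-▷ P e 3≤top = trans (count-upTo-suc (isDescent? p p-prime k (P ▷ e)) (top′ P))
    (cong₂ _+_ (count-upTo-cong _ _ (top′ P) (IsDescent-▷ P e)) (IsDescent-top P e (top′ P) refl 3≤top))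

  -- This bound and the next two show where `des-▷` applies: to edges leaving any W, and to edges
  -- leaving V at level at least 2. A path to level 1 ends in the block numbered 2, which is outside
  -- its range.
  top-V : (P : P[ V (1 + s) l ]) → 2 ≤ top′ P
  top-V (P ▷ _) = s≤s (1≤top P)
    where
    1≤top : ∀ {v} (P : P[ v ]) → 1 ≤ top′ P
    1≤top (start _) = ≤-refl
    1≤top (_ ▷ _)   = s≤s z≤n

  top-W : (P : P[ W (2 + s) l′ ]) → 3 ≤ top′ P
  top-W (P ▷ e₂ _ _) = s≤s (top-V P)

  top-V′ : (P : P[ V (2 + s) l ]) → 3 ≤ top′ P
  top-V′ (P ▷ e₃ _) = m≤n⇒m≤1+n (top-W P)

  -- Summation over paths by their last edge, and the number of paths.

  ∑-paths-▷ : ∀ n v (f : P[ v ] → ℕ) →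
    ∑ (pathsOfLength′ (suc n) v) f ≡
    ∑ (inEdges p p-prime k v) (λ (u , e) → ∑ (pathsOfLength′ n u) (λ P → f (P ▷ e)))
  ∑-paths-▷ n v f =
    trans (∑-concatMap (λ (u , e) → map (_▷ e) (pathsOfLength′ n u)) (inEdges p p-prime k v) f)
          (∑-cong (λ (u , e) → ∑-map (_▷ e) (pathsOfLength′ n u) f) (inEdges p p-prime k v))

  -- The hypothesis covers every proof `eq`, so the particular proof stored in the edges of
  -- `inEdges` never has to be named; `g` may depend on the quotient `t` that labels the edge.
  ∑-paths-V : ∀ n s l (f : P[ V (2 + s) l ] → ℕ) (g : (t : Fin p) → P[ W (2 + s) (src t l) ] → ℕ) →
    (∀ t P eq → f (P ▷ e₃ eq) ≡ g t P) →
    ∑ (pathsOfLength′ (suc n) (V (2 + s) l)) f ≡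
    ∑ (allFin p) (λ t → ∑ (pathsOfLength′ n (W (2 + s) (src t l))) (g t))
  ∑-paths-V n s l f g f≡g =
    trans (∑-paths-▷ n (V (2 + s) l) f)
    (trans (∑-map _ (allFin p) (λ (u , e) → ∑ (pathsOfLength′ n u) (λ P → f (P ▷ e))))
    (∑-cong (λ t → ∑-cong (λ P → f≡g t P _) (pathsOfLength′ n (W (2 + s) (src t l)))) (allFin p)))

  ∑-paths-W : ∀ n s l′ (f : P[ W (2 + s) l′ ] → ℕ) (g : P[ V (1 + s) (srcV l′) ] → ℕ) →
    (∀ P eq → f (P ▷ e₂ (toℕ l′ mod p) eq) ≡ g P) →
    ∑ (pathsOfLength′ (suc n) (W (2 + s) l′)) f ≡ ∑ (pathsOfLength′ n (V (1 + s) (srcV l′))) g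
  ∑-paths-W n s l′ f g f≡g =
    trans (∑-paths-▷ n (W (2 + s) l′) f)
    (trans (+-identityʳ _) (∑-cong (λ P → f≡g P _) (pathsOfLength′ n (V (1 + s) (srcV l′)))))

  -- This counts the paths into `V (1 + s) l`, and equally those into `W (2 + s) l′`: there are p -
  -- 1 edges into level 1, p edges into each later V, and a single edge into each W.
  #paths : ℕ → ℕ
  #paths s = (p ∸ 1) * p ^ s

  -- Paths to `V (1 + s)` have `1 + s * 2` edges and paths to `W (2 + s)` one more. The factor order
  -- `s * 2` lets the length unfold by two at each successor, so the mutual induction needs no
  -- rewriting of lengths.
  ∑-paths-V-const : ∀ s l c → ∑ (pathsOfLength′ (1 + s * 2) (V (1 + s) l)) (λ _ → c) ≡ #paths s * c
  ∑-paths-W-const : ∀ s l′ c → ∑ (pathsOfLength′ (2 + s * 2) (W (2 + s) l′)) (λ _ → c) ≡ #paths s * c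

  ∑-paths-V-const zero l c = begin
    ∑ (pathsOfLength′ 1 (V 1 l)) (λ _ → c)                      ≡⟨ ∑-paths-▷ 0 (V 1 l) (λ _ → c) ⟩
    ∑ (inEdges p p-prime k (V 1 l)) _                           ≡⟨ ∑-map _ (allFin (p ∸ 1)) (λ (u , e) → ∑ (pathsOfLength′ 0 u) (λ _ → c)) ⟩
    ∑ (allFin (p ∸ 1)) (λ _ → c + 0)                            ≡⟨ ∑-allFin-const (p ∸ 1) (c + 0) ⟩
    (p ∸ 1) * (c + 0)                                           ≡⟨ cong₂ _*_ (sym (*-identityʳ (p ∸ 1))) (+-identityʳ c) ⟩
    (p ∸ 1) * 1 * c                                             ∎
    where open ≡-Reasoning
  ∑-paths-V-const (suc s) l c = begin
    ∑ (pathsOfLength′ (3 + s * 2) (V (2 + s) l)) (λ _ → c)      ≡⟨ ∑-paths-V (2 + s * 2) s l (λ _ → c) (λ _ _ → c) (λ _ _ _ → refl) ⟩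
    ∑ (allFin p) (λ t → ∑ (pathsOfLength′ (2 + s * 2) (W (2 + s) (src t l))) (λ _ → c))
                                                                ≡⟨ ∑-cong (λ t → ∑-paths-W-const s (src t l) c) (allFin p) ⟩
    ∑ (allFin p) (λ _ → #paths s * c)                           ≡⟨ ∑-allFin-const p (#paths s * c) ⟩
    p * (#paths s * c)                                          ≡⟨ ring p (p ∸ 1) (p ^ s) c ⟩
    #paths (suc s) * c                                          ∎
    where
    open ≡-Reasoning
    ring : ∀ p d q c → p * (d * q * c) ≡ d * (p * q) * c
    ring = solve-∀
  ∑-paths-W-const s l′ c =
    trans (∑-paths-W (1 + s * 2) s l′ (λ _ → c) (λ _ → c) (λ _ _ → refl)) (∑-paths-V-const s (srcV l′) c)

  -- The blocks of (E2) and (E3) are B_{blockSize - c, c}, where c = leg l′ for the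
  -- edge into W_{s,l′}.

  blockSize : ℕ
  blockSize = p ^ k * (p ∸ 1)

  leg : Fin (p ^ (k + 1)) → ℕ
  leg l′ = (p ∸ 1) * toℕ (srcV l′) + toℕ (toℕ l′ mod p)

  leg≤blockSize : ∀ l′ → leg l′ ≤ blockSize
  leg≤blockSize l′ = begin
    (p ∸ 1) * toℕ (srcV l′) + toℕ (toℕ l′ mod p)    ≤⟨ +-monoʳ-≤ _ (∸-monoˡ-≤ 1 (toℕ<n (toℕ l′ mod p))) ⟩
    (p ∸ 1) * toℕ (srcV l′) + (p ∸ 1)               ≡⟨ trans (+-comm _ (p ∸ 1)) (sym (*-suc (p ∸ 1) _)) ⟩
    (p ∸ 1) * suc (toℕ (srcV l′))                   ≤⟨ *-monoʳ-≤ (p ∸ 1) (toℕ<n (srcV l′)) ⟩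
    (p ∸ 1) * p ^ k                                 ≡⟨ *-comm (p ∸ 1) (p ^ k) ⟩
    blockSize                                       ∎
    where open ≤-Reasoning

  p^k*t≤blockSize : (t : Fin p) → p ^ k * toℕ t ≤ blockSize
  p^k*t≤blockSize t = *-monoʳ-≤ (p ^ k) (∸-monoˡ-≤ 1 (toℕ<n t))

  toℕ-sourceW : ∀ t l → toℕ (src t l) ≡ p ^ k * toℕ t + toℕ l
  toℕ-sourceW t l = toℕ-fromℕ<
    (subst₂ _<_ (toℕ-combine t l) (cong (p ^_) (+-comm 1 k)) (toℕ<n (combine t l)))

  toℕ-sourceV : ∀ l′ → toℕ (srcV l′) ≡ toℕ l′ / p
  toℕ-sourceV l′ = toℕ-fromℕ<
    (m<n*o⇒m/o<n (subst (toℕ l′ <_) (trans (sym (cong (p ^_) (+-comm 1 k))) (*-comm p (p ^ k))) (toℕ<n l′)))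

  -- Since `toℕ l` is below p^k, the quotient in the definition of the block is `t` itself. The
  -- result has the form `B a (q ∸ a)` that `descent-<` and `descent->` expect.
  block-e₃ : ∀ {s} t l (eq : toℕ l ≡ toℕ (src t l) ∸ p ^ k * (toℕ (src t l) / p ^ k)) →
             block′ (e₃ {s = s} eq) ≡ B (p ^ k * toℕ t) (blockSize ∸ p ^ k * toℕ t)
  block-e₃ t l eq = begin
    B (p ^ k * q) (p ^ k * (p ∸ 1 ∸ q))                         ≡⟨ cong (λ q → B (p ^ k * q) (p ^ k * (p ∸ 1 ∸ q))) q≡t ⟩
    B (p ^ k * toℕ t) (p ^ k * (p ∸ 1 ∸ toℕ t))                 ≡⟨ cong (B _) (*-distribˡ-∸ (p ^ k) (p ∸ 1) (toℕ t)) ⟩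
    B (p ^ k * toℕ t) (blockSize ∸ p ^ k * toℕ t)               ∎
    where
    open ≡-Reasoning
    q : ℕ
    q = toℕ (src t l) / p ^ k
    q≡t : q ≡ toℕ t
    q≡t = trans (cong (_/ p ^ k) (toℕ-sourceW t l)) ([q*t+r]/q≡t (p ^ k) (toℕ t) (toℕ<n l))

  -- Descent totals at V and W and their one-step recurrences.

  totalV : ℕ → Fin (p ^ k) → ℕ
  totalV s l = ∑ (pathsOfLength′ (1 + s * 2) (V (1 + s) l)) des′

  totalW : ℕ → Fin (p ^ (k + 1)) → ℕ
  totalW s l′ = ∑ (pathsOfLength′ (2 + s * 2) (W (2 + s) l′)) des′

  𝓜-V : ∀ s l → 𝓜 p p-prime k (V (1 + s) l) ≡ totalV s l
  𝓜-V s l = cong (λ n → ∑ (pathsOfLength′ n (V (1 + s) l)) des′)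
    (trans (cong (_∸ (2 * k + 1)) (ring k s)) (m+n∸m≡n (2 * k + 1) (1 + s * 2)))
    where
    ring : ∀ k s → 2 * (k + (1 + s)) ≡ 2 * k + 1 + (1 + s * 2)
    ring = solve-∀

  -- The only edge into this W fixes its block, while the preceding (E3) block runs through all `t`
  -- below p, each value occurring on `#paths s` paths. Starting from `V (2 + s)` guarantees that
  -- such an (E3) block exists.
  totalW-suc : ∀ s l′ → totalW (suc s) l′ ≡
    totalV (suc s) (srcV l′) + #paths s * ∑ (upTo p) (λ t → ⟦ blockSize <? p ^ k * t + leg l′ ⟧)
  totalW-suc s l′ = begin
    totalW (suc s) l′
      ≡⟨ ∑-paths-W (3 + s * 2) (suc s) l′ des′ (λ P → des′ P + descent (blockAt′ P (top′ P)) e₂-block)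
           (λ P eq → des-▷ P (e₂ (toℕ l′ mod p) eq) (top-V′ P)) ⟩
    ∑ (pathsOfLength′ (3 + s * 2) (V (2 + s) (srcV l′))) (λ P → des′ P + descent (blockAt′ P (top′ P)) e₂-block)
      ≡⟨ ∑-+ (pathsOfLength′ (3 + s * 2) (V (2 + s) (srcV l′))) des′ _ ⟩
    totalV (suc s) (srcV l′) + ∑ (pathsOfLength′ (3 + s * 2) (V (2 + s) (srcV l′))) (λ P → descent (blockAt′ P (top′ P)) e₂-block)
      ≡⟨ cong (totalV (suc s) (srcV l′) +_) lastDescents ⟩
    totalV (suc s) (srcV l′) + #paths s * ∑ (upTo p) (λ t → ⟦ blockSize <? p ^ k * t + leg l′ ⟧) ∎
    where
    open ≡-Reasoning
    e₂-block : Block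
    e₂-block = B (blockSize ∸ leg l′) (leg l′)
    lastDescents : ∑ (pathsOfLength′ (3 + s * 2) (V (2 + s) (srcV l′))) (λ P → descent (blockAt′ P (top′ P)) e₂-block) ≡
                   #paths s * ∑ (upTo p) (λ t → ⟦ blockSize <? p ^ k * t + leg l′ ⟧)
    lastDescents = begin
      ∑ (pathsOfLength′ (3 + s * 2) (V (2 + s) (srcV l′))) (λ P → descent (blockAt′ P (top′ P)) e₂-block)
        -- The new descent depends only on the last edge of `P`. Splitting that edge off leaves a
        -- constant summand for each `t`.
        ≡⟨ ∑-paths-V (2 + s * 2) s (srcV l′) _ (λ t _ → ⟦ blockSize <? p ^ k * toℕ t + leg l′ ⟧)
             (λ t P eq → trans (cong (λ b₃ → descent b₃ e₂-block) (trans (blockAt-top P (e₃ eq)) (block-e₃ {s} t (srcV l′) eq)))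
                               (descent-> (p^k*t≤blockSize t) (leg≤blockSize l′))) ⟩
      ∑ (allFin p) (λ t → ∑ (pathsOfLength′ (2 + s * 2) (W (2 + s) (src t (srcV l′)))) (λ _ → ⟦ blockSize <? p ^ k * toℕ t + leg l′ ⟧))
        ≡⟨ ∑-cong (λ t → ∑-paths-W-const s (src t (srcV l′)) _) (allFin p) ⟩
      ∑ (allFin p) (λ t → #paths s * ⟦ blockSize <? p ^ k * toℕ t + leg l′ ⟧)
        ≡⟨ ∑-*ˡ (#paths s) (allFin p) _ ⟩
      #paths s * ∑ (allFin p) (λ t → ⟦ blockSize <? p ^ k * toℕ t + leg l′ ⟧)
        ≡⟨ cong (#paths s *_) (∑-allFin p (λ t → ⟦ blockSize <? p ^ k * t + leg l′ ⟧)) ⟩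
      #paths s * ∑ (upTo p) (λ t → ⟦ blockSize <? p ^ k * t + leg l′ ⟧) ∎

  -- Dually to `totalW-suc`, the last edge varies with `t`. For each `t` the preceding (E2) block is
  -- forced by the index of W, so all `#paths s` paths through that W agree on the new descent.
  totalV-suc : ∀ s l → totalV (suc s) l ≡
    ∑ (allFin p) (λ t → totalW s (src t l) + #paths s * ⟦ p ^ k * toℕ t + leg (src t l) <? blockSize ⟧)
  totalV-suc s l = begin
    totalV (suc s) l
      ≡⟨ ∑-paths-V (2 + s * 2) s l des′ (λ t P → des′ P + descent (blockAt′ P (top′ P)) (e₃-block t))
           (λ t P eq → trans (des-▷ P (e₃ eq) (top-W P))
                             (cong (λ b₃ → des′ P + descent (blockAt′ P (top′ P)) b₃) (block-e₃ {s} t l eq))) ⟩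
    ∑ (allFin p) (λ t → ∑ (pathsOfLength′ (2 + s * 2) (W (2 + s) (src t l))) (λ P → des′ P + descent (blockAt′ P (top′ P)) (e₃-block t)))
      ≡⟨ ∑-cong (λ t → trans (∑-+ (pathsOfLength′ (2 + s * 2) (W (2 + s) (src t l))) des′ _)
                             (cong (totalW s (src t l) +_) (lastDescents t))) (allFin p) ⟩
    ∑ (allFin p) (λ t → totalW s (src t l) + #paths s * ⟦ p ^ k * toℕ t + leg (src t l) <? blockSize ⟧) ∎
    where
    open ≡-Reasoning
    e₃-block : Fin p → Block
    e₃-block t = B (p ^ k * toℕ t) (blockSize ∸ p ^ k * toℕ t)
    lastDescents : ∀ t →
      ∑ (pathsOfLength′ (2 + s * 2) (W (2 + s) (src t l))) (λ P → descent (blockAt′ P (top′ P)) (e₃-block t)) ≡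
      #paths s * ⟦ p ^ k * toℕ t + leg (src t l) <? blockSize ⟧
    lastDescents t = trans
      (∑-paths-W (1 + s * 2) s (src t l) _ (λ _ → ⟦ p ^ k * toℕ t + leg (src t l) <? blockSize ⟧)
        (λ P eq → trans (cong (λ b₂ → descent b₂ (e₃-block t)) (blockAt-top P (e₂ (toℕ (src t l) mod p) eq)))
                        (descent-< (p^k*t≤blockSize t) (leg≤blockSize (src t l)))))
      (∑-paths-V-const s (srcV (src t l)) _)

-- The cases k = 0 and k = 1

odd⇒≡1+2*h : ∀ {p} → ¬ 2 ∣ p → ∃ λ h → p ≡ 1 + 2 * h
odd⇒≡1+2*h {p} ¬2∣p with p % 2 in p%2≡r | m%n<n p 2 | m≡m%n+[m/n]*n p 2
... | 0 | _ | _ = contradiction (m%n≡0⇒n∣m p 2 p%2≡r) ¬2∣p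
... | 1 | _ | p≡ = p / 2 , trans p≡ (cong suc (*-comm (p / 2) 2))
... | suc (suc _) | s≤s (s≤s ()) | _

-- This makes the bracket [0 < h] equal to 1 when the index 0 is expanded in `recurrence₁`.
prime[1+2*h]⇒1≤h : ∀ h → Prime (1 + 2 * h) → 1 ≤ h
prime[1+2*h]⇒1≤h zero    p-prime = contradiction p-prime ¬prime[1]
prime[1+2*h]⇒1≤h (suc _) _       = s≤s z≤n

-- This is the lexicographic comparison of two numbers with last digits `r` and `r′` in base `e`.
-- The bracket relaxes the strict inequality of the leading digits exactly when the last digits
-- decide a tie.
*+-<-lex : ∀ {e a r c r′} → r < e → r′ < e → (e * a + r < e * c + r′) ⇔ (a < c + ⟦ r <? r′ ⟧)
*+-<-lex {e} {a} {r} {c} {r′} r<e r′<e with r <? r′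
... | yes r<r′ rewrite dec-true (r <? r′) r<r′ | +-comm c 1 = mk⇔
  (λ lt → s≤s (≮⇒≥ (λ c<a → <-asym lt (begin-strict
    e * c + r′    <⟨ +-monoʳ-< (e * c) r′<e ⟩
    e * c + e     ≡⟨ trans (+-comm (e * c) e) (sym (*-suc e c)) ⟩
    e * suc c     ≤⟨ *-monoʳ-≤ e c<a ⟩
    e * a         ≤⟨ m≤m+n (e * a) r ⟩
    e * a + r     ∎))))
  (λ a<1+c → +-mono-≤-< (*-monoʳ-≤ e (s≤s⁻¹ a<1+c)) r<r′)
  where open ≤-Reasoning
... | no r≮r′ rewrite dec-false (r <? r′) r≮r′ | +-identityʳ c = mk⇔
  (λ lt → ≰⇒> (λ c≤a → <⇒≱ lt (+-mono-≤ (*-monoʳ-≤ e c≤a) (≮⇒≥ r≮r′))))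
  (λ a<c → begin-strict
    e * a + r     <⟨ +-monoʳ-< (e * a) r<e ⟩
    e * a + e     ≡⟨ trans (+-comm (e * a) e) (sym (*-suc e a)) ⟩
    e * suc a     ≤⟨ *-monoʳ-≤ e a<c ⟩
    e * c         ≤⟨ m≤m+n (e * c) r′ ⟩
    e * c + r′    ∎)
  where open ≤-Reasoning

module _ (h : ℕ) (p-prime : Prime (1 + 2 * h)) where

  private
    p = 1 + 2 * h

    h≤p : h ≤ p
    h≤p = ≤-trans (m≤m+n h (h + 0)) (n≤1+n (2 * h))

    N : (k s : ℕ) → ℕ
    N = #paths p p-prime

  leg-sourceW₀ : ∀ t → leg p p-prime 0 (sourceW p p-prime 0 t zero) ≡ toℕ t
  leg-sourceW₀ t = begin
    2 * h * toℕ (sourceV p p-prime 0 l′) + toℕ (toℕ l′ mod p)    ≡⟨ cong₂ (λ a c → 2 * h * a + c) (n<1⇒n≡0 (toℕ<n (sourceV p p-prime 0 l′))) (toℕ-fromℕ< (m%n<n (toℕ l′) p)) ⟩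
    2 * h * 0 + toℕ l′ % p                                       ≡⟨ cong₂ (λ a c → a + c % p) (*-zeroʳ (2 * h)) l′≡t ⟩
    toℕ t % p                                                    ≡⟨ m<n⇒m%n≡m (toℕ<n t) ⟩
    toℕ t                                                        ∎
    where
    open ≡-Reasoning
    l′ = sourceW p p-prime 0 t zero
    l′≡t : toℕ l′ ≡ toℕ t
    l′≡t = trans (toℕ-sourceW p p-prime 0 t zero) (trans (+-identityʳ _) (*-identityˡ (toℕ t)))

  -- With one vertex per V level, the leg into W with index `t` is `t`. There are `t` values t′ with
  -- t′ + t > p - 1, and these add up to p h over all `t`; the closing (E3) edge gives a descent
  -- when 2t < 2h, that is, for h values of `t`.
  totalV₀-suc : ∀ s → totalV p p-prime 0 (2 + s) zero ≡
    p * totalV p p-prime 0 (1 + s) zero + N 0 s * (p * h) + N 0 (1 + s) * h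
  totalV₀-suc s = begin
    totalV p p-prime 0 (2 + s) zero
      ≡⟨ totalV-suc p p-prime 0 (1 + s) zero ⟩
    ∑ (allFin p) (λ t → totalW p p-prime 0 (1 + s) (src t) + N 0 (1 + s) * ⟦ 1 * toℕ t + leg p p-prime 0 (src t) <? 1 * (2 * h) ⟧)
      ≡⟨ ∑-cong step (allFin p) ⟩
    ∑ (allFin p) (λ t → M + N 0 s * toℕ t + N 0 (1 + s) * ⟦ toℕ t <? h ⟧)
      ≡⟨ ∑-+ (allFin p) (λ t → M + N 0 s * toℕ t) _ ⟩
    ∑ (allFin p) (λ t → M + N 0 s * toℕ t) + ∑ (allFin p) (λ t → N 0 (1 + s) * ⟦ toℕ t <? h ⟧)
      ≡⟨ cong₂ _+_ (∑-+ (allFin p) (λ _ → M) _) (∑-*ˡ (N 0 (1 + s)) (allFin p) _) ⟩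
    ∑ (allFin p) (λ _ → M) + ∑ (allFin p) (λ t → N 0 s * toℕ t) + N 0 (1 + s) * ∑ (allFin p) (λ t → ⟦ toℕ t <? h ⟧)
      ≡⟨ cong₂ _+_ (cong₂ _+_ (∑-allFin-const p M)
                              (trans (∑-*ˡ (N 0 s) (allFin p) toℕ) (cong (N 0 s *_) (trans (∑-allFin p id) (∑-upTo-id h)))))
                   (cong (N 0 (1 + s) *_) (trans (∑-allFin p (λ t → ⟦ t <? h ⟧)) (∑-upTo-< p h≤p))) ⟩
    p * M + N 0 s * (p * h) + N 0 (1 + s) * h ∎
    where
    open ≡-Reasoning
    src : Fin p → Fin (p ^ 1)
    src t = sourceW p p-prime 0 t zero
    M : ℕ
    M = totalV p p-prime 0 (1 + s) zero
    double : ∀ t → 1 * t + t ≡ 2 * t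
    double = solve-∀
    oddDescents : ∀ t → ⟦ 1 * toℕ t + leg p p-prime 0 (src t) <? 1 * (2 * h) ⟧ ≡ ⟦ toℕ t <? h ⟧
    oddDescents t rewrite leg-sourceW₀ t | double (toℕ t) | *-identityˡ (2 * h) =
      ⟦⟧-cong (mk⇔ (*-cancelˡ-< 2 (toℕ t) h) (*-monoʳ-< 2)) (2 * toℕ t <? 2 * h) (toℕ t <? h)
    evenDescents : ∀ t → ∑ (upTo p) (λ t′ → ⟦ 1 * (2 * h) <? 1 * t′ + leg p p-prime 0 (src t) ⟧) ≡ toℕ t
    evenDescents t rewrite leg-sourceW₀ t = trans
      (∑-cong (λ t′ → cong₂ (λ a c → ⟦ a <? c + toℕ t ⟧) (*-identityˡ (2 * h)) (*-identityˡ t′)) (upTo p))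
      -- By definition `2 * h < x` is `p ≤ x`, so the count of the last positions applies directly.
      (∑-upTo-≤+ p (<⇒≤ (toℕ<n t)))
    sourceV≡zero : ∀ (l : Fin 1) → l ≡ zero
    sourceV≡zero zero = refl
    step : ∀ t → totalW p p-prime 0 (1 + s) (src t) + N 0 (1 + s) * ⟦ 1 * toℕ t + leg p p-prime 0 (src t) <? 1 * (2 * h) ⟧ ≡
                 M + N 0 s * toℕ t + N 0 (1 + s) * ⟦ toℕ t <? h ⟧
    step t = cong₂ _+_
      (trans (totalW-suc p p-prime 0 s (src t))
             (cong₂ (λ l a → totalV p p-prime 0 (1 + s) l + N 0 s * a) (sourceV≡zero (sourceV p p-prime 0 (src t))) (evenDescents t)))
      (cong (N 0 (1 + s) *_) (oddDescents t))

  recurrence₀ : ∀ n → 𝓜 p p-prime 0 (V (4 + n) zero) ≡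
    p * 𝓜 p p-prime 0 (V (2 + n) zero) + 2 * h * 𝓜 p p-prime 0 (V (3 + n) zero) + p ^ (1 + n) * (2 * h) * (p ^ 2 ∸ 1)
  recurrence₀ n = begin
    𝓜 p p-prime 0 (V (4 + n) zero)
      ≡⟨ 𝓜-V p p-prime 0 (3 + n) zero ⟩
    totalV p p-prime 0 (3 + n) zero
      ≡⟨ totalV₀-suc (1 + n) ⟩
    p * totalV p p-prime 0 (2 + n) zero + N 0 (1 + n) * (p * h) + N 0 (2 + n) * h
      -- Split p M′ as M′ + (p - 1) M′ and expand only the first copy by the recurrence one level
      -- down.
      ≡⟨ ring h (p ^ n) (totalV p p-prime 0 (1 + n) zero) (totalV p p-prime 0 (2 + n) zero) (totalV₀-suc n) ⟩
    p * totalV p p-prime 0 (1 + n) zero + 2 * h * totalV p p-prime 0 (2 + n) zero + p ^ (1 + n) * (2 * h) * (p ^ 2 ∸ 1)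
      ≡⟨ cong₂ (λ M M′ → p * M + 2 * h * M′ + p ^ (1 + n) * (2 * h) * (p ^ 2 ∸ 1))
               (𝓜-V p p-prime 0 (1 + n) zero) (𝓜-V p p-prime 0 (2 + n) zero) ⟨
    p * 𝓜 p p-prime 0 (V (2 + n) zero) + 2 * h * 𝓜 p p-prime 0 (V (3 + n) zero) + p ^ (1 + n) * (2 * h) * (p ^ 2 ∸ 1) ∎
    where
    open ≡-Reasoning
    -- The last factor on the right is what `p ^ 2 ∸ 1` computes to, so the ring solver never meets
    -- a subtraction.
    ring′ : ∀ h q M →
      let p = 1 + 2 * h
          M′ = p * M + 2 * h * q * (p * h) + 2 * h * (p * q) * h
      in p * M′ + 2 * h * (p * q) * (p * h) + 2 * h * (p * (p * q)) * h ≡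
         p * M + 2 * h * M′ + p * q * (2 * h) * (2 * h * 1 + 2 * h * (p * 1))
    ring′ = solve-∀
    ring : ∀ h q M M′ →
      let p = 1 + 2 * h in
      M′ ≡ p * M + 2 * h * q * (p * h) + 2 * h * (p * q) * h →
      p * M′ + 2 * h * (p * q) * (p * h) + 2 * h * (p * (p * q)) * h ≡
      p * M + 2 * h * M′ + p * q * (2 * h) * (p ^ 2 ∸ 1)
    ring h q M _ refl = ring′ h q M

  -- For k = 1 both p^k and the divisor in (E2) are p. Hence the W with index p t + l, reached from
  -- V with index l by undoing (E3), comes from V with index `t`; letting `t` vary runs through all
  -- vertices of the level below.
  sourceV-sourceW₁ : ∀ t l → sourceV p p-prime 1 (sourceW p p-prime 1 t l) ≡ index₁ t
  sourceV-sourceW₁ t l = toℕ-injective (begin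
    toℕ (sourceV p p-prime 1 (sourceW p p-prime 1 t l))    ≡⟨ toℕ-sourceV p p-prime 1 (sourceW p p-prime 1 t l) ⟩
    toℕ (sourceW p p-prime 1 t l) / p                      ≡⟨ cong (_/ p) (toℕ-sourceW p p-prime 1 t l) ⟩
    (p ^ 1 * toℕ t + toℕ l) / p                            ≡⟨ cong (λ q → (q * toℕ t + toℕ l) / p) (^-identityʳ p) ⟩
    (p * toℕ t + toℕ l) / p                                ≡⟨ [q*t+r]/q≡t p (toℕ t) (subst (toℕ l <_) (^-identityʳ p) (toℕ<n l)) ⟩
    toℕ t                                                  ≡⟨ toℕ-cast (sym (^-identityʳ p)) t ⟨
    toℕ (index₁ t)                                         ∎)
    where open ≡-Reasoning

  leg-sourceW₁ : ∀ t l → leg p p-prime 1 (sourceW p p-prime 1 t l) ≡ 2 * h * toℕ t + toℕ l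
  leg-sourceW₁ t l = cong₂ (λ a c → 2 * h * a + c)
    (trans (cong toℕ (sourceV-sourceW₁ t l)) (toℕ-cast (sym (^-identityʳ p)) t))
    (begin
      toℕ (toℕ l′ mod p)                 ≡⟨ toℕ-fromℕ< (m%n<n (toℕ l′) p) ⟩
      toℕ l′ % p                         ≡⟨ cong (_% p) (toℕ-sourceW p p-prime 1 t l) ⟩
      (p ^ 1 * toℕ t + toℕ l) % p        ≡⟨ cong (λ q → (q * toℕ t + toℕ l) % p) (^-identityʳ p) ⟩
      (p * toℕ t + toℕ l) % p            ≡⟨ cong (_% p) (trans (+-comm _ (toℕ l)) (cong (toℕ l +_) (*-comm p (toℕ t)))) ⟩
      (toℕ l + toℕ t * p) % p            ≡⟨ [m+kn]%n≡m%n (toℕ l) (toℕ t) p ⟩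
      toℕ l % p                          ≡⟨ m<n⇒m%n≡m (subst (toℕ l <_) (^-identityʳ p) (toℕ<n l)) ⟩
      toℕ l                              ∎)
    where
    open ≡-Reasoning
    l′ = sourceW p p-prime 1 t l

  -- The branch `t` comes from `index₁ t` and has leg (p - 1) t + l. Its even-index comparison gives
  -- `ε t` descents, counted over the preceding (E3) blocks, and its odd-index comparison gives
  -- `δ t`; summing these over `t` yields the two inhomogeneous terms.
  totalV₁-suc : ∀ s l → totalV p p-prime 1 (2 + s) l ≡
    ∑ (allFin p) (λ t → totalV p p-prime 1 (1 + s) (index₁ t))
      + N 1 s * (p * h + toℕ l) + N 1 (1 + s) * (h + ⟦ toℕ l <? h ⟧)
  totalV₁-suc s l = begin
    totalV p p-prime 1 (2 + s) l
      ≡⟨ totalV-suc p p-prime 1 (1 + s) l ⟩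
    ∑ (allFin p) (λ t → totalW p p-prime 1 (1 + s) (src t) + N 1 (1 + s) * ⟦ p ^ 1 * toℕ t + leg p p-prime 1 (src t) <? p ^ 1 * (2 * h) ⟧)
      ≡⟨ ∑-cong step (allFin p) ⟩
    ∑ (allFin p) (λ t → M t + N 1 s * ε t + N 1 (1 + s) * δ t)
      ≡⟨ ∑-+ (allFin p) (λ t → M t + N 1 s * ε t) _ ⟩
    ∑ (allFin p) (λ t → M t + N 1 s * ε t) + ∑ (allFin p) (λ t → N 1 (1 + s) * δ t)
      ≡⟨ cong₂ _+_ (∑-+ (allFin p) M _) (∑-*ˡ (N 1 (1 + s)) (allFin p) δ) ⟩
    ∑ (allFin p) M + ∑ (allFin p) (λ t → N 1 s * ε t) + N 1 (1 + s) * ∑ (allFin p) δ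
      ≡⟨ cong₂ (λ a c → ∑ (allFin p) M + a + N 1 (1 + s) * c)
               (trans (∑-*ˡ (N 1 s) (allFin p) ε) (cong (N 1 s *_) ∑-ε)) ∑-δ ⟩
    ∑ (allFin p) M + N 1 s * (p * h + toℕ l) + N 1 (1 + s) * (h + ⟦ toℕ l <? h ⟧) ∎
    where
    open ≡-Reasoning
    src : Fin p → Fin (p ^ 2)
    src t = sourceW p p-prime 1 t l
    M ε δ : Fin p → ℕ
    M t = totalV p p-prime 1 (1 + s) (index₁ t)
    ε t = toℕ t + ⟦ toℕ t <? toℕ l ⟧
    δ t = ⟦ toℕ t <? h + ⟦ toℕ l <? h ⟧ ⟧
    l<p : toℕ l < p
    l<p = subst (toℕ l <_) (^-identityʳ p) (toℕ<n l)
    ⟦⟧≤1 : {A : Set} (a? : Dec A) → ⟦ a? ⟧ ≤ 1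
    ⟦⟧≤1 a? with does a?
    ... | true  = ≤-refl
    ... | false = z≤n
    ∑-ε : ∑ (allFin p) ε ≡ p * h + toℕ l
    ∑-ε = trans (∑-+ (allFin p) toℕ _)
      (cong₂ _+_ (trans (∑-allFin p id) (∑-upTo-id h))
                 (trans (∑-allFin p (λ t → ⟦ t <? toℕ l ⟧)) (∑-upTo-< p (<⇒≤ l<p))))
    ∑-δ : ∑ (allFin p) δ ≡ h + ⟦ toℕ l <? h ⟧
    ∑-δ = trans (∑-allFin p (λ t → ⟦ t <? h + ⟦ toℕ l <? h ⟧ ⟧))
      (∑-upTo-< p (subst (h + ⟦ toℕ l <? h ⟧ ≤_) (+-comm (2 * h) 1) (+-mono-≤ (m≤m+n h (h + 0)) (⟦⟧≤1 (toℕ l <? h)))))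
    -- The two coefficients of `t` add up to 2p - 1 = 4h + 1, and p(p - 1) = (4h + 1) h + h. The
    -- test therefore compares the digit pairs (t, l) and (h, h) in base 4h + 1.
    oddDescents : ∀ t → ⟦ p ^ 1 * toℕ t + leg p p-prime 1 (src t) <? p ^ 1 * (2 * h) ⟧ ≡ δ t
    oddDescents t rewrite leg-sourceW₁ t l = trans
      (cong₂ (λ a c → ⟦ a <? c ⟧) (ring₁ h (toℕ t) (toℕ l)) (ring₂ h))
      (⟦⟧-cong (*+-<-lex (<-≤-trans l<p (s≤s (*-monoˡ-≤ h 2≤4))) (s≤s (m≤n*m h 4)))
               ((1 + 4 * h) * toℕ t + toℕ l <? (1 + 4 * h) * h + h) (toℕ t <? h + ⟦ toℕ l <? h ⟧))
      where
      2≤4 : 2 ≤ 4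
      2≤4 = s≤s (s≤s z≤n)
      ring₁ : ∀ h t l → (1 + 2 * h) * 1 * t + (2 * h * t + l) ≡ (1 + 4 * h) * t + l
      ring₁ = solve-∀
      ring₂ : ∀ h → (1 + 2 * h) * 1 * (2 * h) ≡ (1 + 4 * h) * h + h
      ring₂ = solve-∀
    evenDescents : ∀ t → ∑ (upTo p) (λ t′ → ⟦ p ^ 1 * (2 * h) <? p ^ 1 * t′ + leg p p-prime 1 (src t) ⟧) ≡ ε t
    evenDescents t rewrite leg-sourceW₁ t l = trans
      (∑-cong (λ t′ → ⟦⟧-cong (cond t′) (p ^ 1 * (2 * h) <? p ^ 1 * t′ + (2 * h * toℕ t + toℕ l)) (p ≤? t′ + ε t)) (upTo p))
      (∑-upTo-≤+ p (≤-trans (+-monoʳ-≤ (toℕ t) (⟦⟧≤1 (toℕ t <? toℕ l))) (subst (_≤ p) (+-comm 1 (toℕ t)) (toℕ<n t))))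
      where
      ring₁ : ∀ h t → (1 + 2 * h) * (2 * h) + t ≡ (1 + 2 * h) * 1 * (2 * h) + t
      ring₁ = solve-∀
      ring₂ : ∀ h t′ t l → (1 + 2 * h) * (t′ + t) + l ≡ (1 + 2 * h) * 1 * t′ + (2 * h * t + l) + t
      ring₂ = solve-∀
      -- After adding t to both sides, the inequality compares two numbers written in base p.
      cond : ∀ t′ → (p ^ 1 * (2 * h) < p ^ 1 * t′ + (2 * h * toℕ t + toℕ l)) ⇔ (p ≤ t′ + ε t)
      cond t′ = mk⇔
        (λ lt → subst (2 * h <_) (+-assoc t′ (toℕ t) _)
          (to (*+-<-lex (toℕ<n t) l<p)
            (subst₂ _<_ (sym (ring₁ h (toℕ t))) (sym (ring₂ h t′ (toℕ t) (toℕ l))) (+-monoˡ-< (toℕ t) lt))))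
        (λ le → +-cancelʳ-< (toℕ t) _ _ (subst₂ _<_ (ring₁ h (toℕ t)) (ring₂ h t′ (toℕ t) (toℕ l))
          (from (*+-<-lex (toℕ<n t) l<p) (subst (2 * h <_) (sym (+-assoc t′ (toℕ t) _)) le))))
    step : ∀ t → totalW p p-prime 1 (1 + s) (src t) + N 1 (1 + s) * ⟦ p ^ 1 * toℕ t + leg p p-prime 1 (src t) <? p ^ 1 * (2 * h) ⟧ ≡
                 M t + N 1 s * ε t + N 1 (1 + s) * δ t
    step t = cong₂ _+_
      (trans (totalW-suc p p-prime 1 s (src t))
             (cong₂ (λ l a → totalV p p-prime 1 (1 + s) l + N 1 s * a) (sourceV-sourceW₁ t l) (evenDescents t)))
      (cong (N 1 (1 + s) *_) (oddDescents t))

  -- A single formula with a bracket replaces the two cases of `b`, so that the ring solver can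
  -- treat the bracket as a variable.
  b-closed : ∀ s t → b p s t ≡ p ^ (s ∸ 1) * (2 * h) * (p ^ 2 + p * ⟦ t <? h ⟧ + t)
  b-closed s t rewrite trans (cong (_/ 2) (*-comm 2 h)) (m*n/n≡m h 2) with does (t <? h)
  ... | true  = cong (λ a → p ^ (s ∸ 1) * (2 * h) * (p ^ 2 + a + t)) (sym (*-identityʳ p))
  ... | false = cong (λ a → p ^ (s ∸ 1) * (2 * h) * (a + t)) (sym (trans (cong (p ^ 2 +_) (*-zeroʳ p)) (+-identityʳ (p ^ 2))))

  recurrence₁ : ∀ n t → 𝓜 p p-prime 1 (V (4 + n) (index₁ t)) ≡
    ∑ (allFin p) (λ t₂ → 𝓜 p p-prime 1 (V (2 + n) (index₁ t₂)))
      + ∑ (filter (λ t₁ → 1 ≤? toℕ t₁) (allFin p)) (λ t₁ → 𝓜 p p-prime 1 (V (3 + n) (index₁ t₁)))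
      + b p (2 + n) (toℕ t)
  recurrence₁ n t = begin
    𝓜 p p-prime 1 (V (4 + n) (index₁ t))
      ≡⟨ 𝓜-V p p-prime 1 (3 + n) (index₁ t) ⟩
    totalV p p-prime 1 (3 + n) (index₁ t)
      ≡⟨ totalV₁-suc (1 + n) (index₁ t) ⟩
    ∑ (allFin p) (T 2) + N 1 (1 + n) * (p * h + toℕ (index₁ t)) + N 1 (2 + n) * (h + ⟦ toℕ (index₁ t) <? h ⟧)
      -- Only the term with index 0 is expanded one level further, which produces the full sum `Σ₁`.
      -- The terms with positive index remain as `R`, the middle sum of the theorem.
      ≡⟨ cong₂ (λ a c → a + N 1 (1 + n) * (p * h + c) + N 1 (2 + n) * (h + ⟦ c <? h ⟧))
               (trans (∑-filter-positive (T 2)) (cong (_+ R) T₂-zero)) (toℕ-cast (sym (^-identityʳ p)) t) ⟩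
    Σ₁ + N 1 n * (p * h + 0) + N 1 (1 + n) * (h + 1) + R + N 1 (1 + n) * (p * h + toℕ t) + N 1 (2 + n) * (h + ⟦ toℕ t <? h ⟧)
      ≡⟨ ring h (p ^ n) Σ₁ R (toℕ t) ⟦ toℕ t <? h ⟧ ⟩
    Σ₁ + R + p ^ (1 + n) * (2 * h) * (p ^ 2 + p * ⟦ toℕ t <? h ⟧ + toℕ t)
      ≡⟨ cong₂ _+_ (cong₂ _+_ (∑-cong (λ t₂ → 𝓜-V p p-prime 1 (1 + n) (index₁ t₂)) (allFin p))
                              (∑-cong (λ t₁ → 𝓜-V p p-prime 1 (2 + n) (index₁ t₁)) (filter (λ t₁ → 1 ≤? toℕ t₁) (allFin p))))
                   (b-closed (2 + n) (toℕ t)) ⟨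
    ∑ (allFin p) (λ t₂ → 𝓜 p p-prime 1 (V (2 + n) (index₁ t₂)))
      + ∑ (filter (λ t₁ → 1 ≤? toℕ t₁) (allFin p)) (λ t₁ → 𝓜 p p-prime 1 (V (3 + n) (index₁ t₁)))
      + b p (2 + n) (toℕ t) ∎
    where
    open ≡-Reasoning
    T : ℕ → Fin p → ℕ
    T i t = totalV p p-prime 1 (i + n) (index₁ t)
    Σ₁ R : ℕ
    Σ₁ = ∑ (allFin p) (T 1)
    R = ∑ (filter (λ t₁ → 1 ≤? toℕ t₁) (allFin p)) (T 2)
    T₂-zero : T 2 zero ≡ Σ₁ + N 1 n * (p * h + 0) + N 1 (1 + n) * (h + 1)
    T₂-zero = trans (totalV₁-suc n (index₁ {p} zero))
      (cong₂ (λ a c → Σ₁ + N 1 n * (p * h + a) + N 1 (1 + n) * (h + c)) (toℕ-cast (sym (^-identityʳ p)) (zero {n = 2 * h}))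
        (⟦⟧-yes (toℕ (index₁ {p} zero) <? h) (subst (_< h) (sym (toℕ-cast (sym (^-identityʳ p)) (zero {n = 2 * h}))) (prime[1+2*h]⇒1≤h h p-prime))))
    ring : ∀ h q Σ₁ R t i →
      let p = 1 + 2 * h in
      Σ₁ + 2 * h * q * (p * h + 0) + 2 * h * (p * q) * (h + 1) + R + 2 * h * (p * q) * (p * h + t) + 2 * h * (p * (p * q)) * (h + i) ≡
      Σ₁ + R + p * q * (2 * h) * (p * (p * 1) + p * i + t)
    ring = solve-∀

mainTheorem13 : (p : ℕ) (p-prime : Prime p) → ¬ 2 ∣ p →
    ((s : ℕ) .{{_ : NonZero s}} → 2 ≤ s →
    𝓜 p p-prime 0 (V (2 + s) zero)
    ≡ p * 𝓜 p p-prime 0 (V s zero)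
    + (p ∸ 1) * 𝓜 p p-prime 0 (V (1 + s) zero)
    + p ^ (s ∸ 1) * (p ∸ 1) * (p ^ 2 ∸ 1))
    ×
    ((s : ℕ) .{{_ : NonZero s}} → 3 ≤ s → (t : Fin p) →
    𝓜 p p-prime 1 (V (2 + s) (index₁ t))
    ≡ ∑ (allFin p) (λ t₂ → 𝓜 p p-prime 1 (V s (index₁ t₂)))
    + ∑ (filter (λ t₁ → 1 ≤? toℕ t₁) (allFin p)) (λ t₁ → 𝓜 p p-prime 1 (V (1 + s) (index₁ t₁)))
    + b p s (toℕ t))
mainTheorem13 p p-prime ¬2∣p with odd⇒≡1+2*h ¬2∣p
... | h , refl =
  -- Both recurrences are stated at s = 2 + n; the value 0 is excluded by the `NonZero` instance and
  -- 1 by the lower bound on `s`.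
  (λ { 1 (s≤s ()) ; (suc (suc n)) _ → recurrence₀ h p-prime n }) ,
  (λ { 1 (s≤s ()) ; (suc (suc n)) _ → recurrence₁ h p-prime n })
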